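{- Let $r \ge 2$ be an integer, and let $E$ be the (finite) set of edges of some $r$-uniform hypergraph on a finite vertex set $V$. Let $\mathbf{a} = \{a_e\}_{e\in E}$ and $\mathbf{b} = \{b_v\}_{v\in V}$ be systems of positive real weights, and write $\underline{a} = \min_{e\in E} a_e$ and $\underline{b} = \min_{v \in V} b_v$. Let $n > \underline{a}\,\underline{b}$ be a real number. Then the simplicial complex $X = \{E' \subseteq E:\ \nu^*_{\mathbf{a},\mathbf{b}}(E') < n\}$ on the vertex set $E$ is $\left(\lceil \frac{rn}{\underline{a}\,\underline{b}} \rceil - 1\right)$-collapsible.
   Context: For $E' \subseteq E$, $\nu^*_{\mathbf{a},\mathbf{b}}(E')$ is the maximum of $\sum_{e\in E'} a_e f(e)$ over all $f\colon E'\to\mathbb{R}$ with $f(e)\ge 0$ for all $e\in E'$ and $\sum_{e\in E',\, e\ni v} f(e) \le b_v$ for all $v\in V$. A simplicial complex is a family of subsets closed under taking subsets; a facet is an inclusion-maximal face. For a positive integer $d$: if $\sigma$ is a face of $X$ contained in a unique facet of $X$ and $|\sigma| \le d$, removing $\sigma$ and all faces containing it is an elementary $d$-collapse; $X$ is $d$-collapsible if a finite sequence of elementary $d$-collapses reduces $X$ to $\{\emptyset\}$. -}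

module Defs where

open import Level using (Level; _⊔_) renaming (suc to lsuc)
open import Data.Nat using (ℕ; zero; suc)
open import Data.Bool using (Bool; true; false; if_then_else_)
open import Data.Fin using (Fin; zero; suc)
open import Data.Fin.Subset using (Subset; _⊆_; ∣_∣; ⊥)
open import Data.Vec using (lookup)
open import Data.Product using (Σ; ∃; _×_; _,_)
open import Data.Sum using (_⊎_)
open import Relation.Nullary using (¬_)
open import Relation.Binary.PropositionalEquality using (_≡_; _≢_)
open import Relation.Binary.Structures using (IsStrictTotalOrder)
open import Algebra.Structures using (IsCommutativeRing)
open import Function.Bundles using (_⇔_)

-- The real numbers, axiomatised as a complete ordered field.
-- (agda-stdlib has no real numbers; every model of this record is,
-- classically, isomorphic to ℝ.)  The theorem is stated for every model.

record RealField (c : Level) : Set (lsuc c) where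
  infixl 6 _+_
  infixl 7 _*_
  infix  4 _<_ _≤_
  field
    Carrier : Set c
    0# 1#   : Carrier
    _+_ _*_ : Carrier → Carrier → Carrier
    -_      : Carrier → Carrier
    _<_     : Carrier → Carrier → Set c
    isCommutativeRing : IsCommutativeRing _≡_ _+_ _*_ -_ 0# 1#
    0≢1     : 0# ≢ 1#
    inverse : ∀ x → x ≢ 0# → ∃ λ y → x * y ≡ 1#
    isStrictTotalOrder : IsStrictTotalOrder _≡_ _<_
    +-mono-< : ∀ {x y} z → x < y → x + z < y + z
    *-pos    : ∀ {x y} → 0# < x → 0# < y → 0# < x * y

  _≤_ : Carrier → Carrier → Set c
  x ≤ y = x < y ⊎ x ≡ y

  field
    complete : (P : Carrier → Set c) → (∃ λ x → P x) →
               (∃ λ u → ∀ x → P x → x ≤ u) →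
               ∃ λ s → (∀ x → P x → x ≤ s) ×
                       (∀ u → (∀ x → P x → x ≤ u) → s ≤ u)

  fromℕ : ℕ → Carrier
  fromℕ zero    = 0#
  fromℕ (suc k) = 1# + fromℕ k

  sumFin : (n : ℕ) → (Fin n → Carrier) → Carrier
  sumFin zero    g = 0#
  sumFin (suc n) g = g zero + sumFin n (λ i → g (suc i))

-- Fractional (a,b)-matching number.
-- Vertex set V = Fin nv, edge set E = Fin m, edge e is the vertex set
-- `edge e`.  Faces E' ⊆ E are `Subset m`.

module Matching {c} (R : RealField c) {nv m : ℕ}
                (edge : Fin m → Subset nv)
                (a : Fin m → RealField.Carrier R)
                (b : Fin nv → RealField.Carrier R) where
  open RealField R

  value : Subset m → (Fin m → Carrier) → Carrier
  value E' f = sumFin m (λ e → if lookup E' e then a e * f e else 0#)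

  load : Subset m → (Fin m → Carrier) → Fin nv → Carrier
  load E' f v = sumFin m (λ e →
    if lookup E' e then (if lookup (edge e) v then f e else 0#) else 0#)

  -- f (only its values on E' matter) is a feasible fractional matching
  Feasible : Subset m → (Fin m → Carrier) → Set c
  Feasible E' f = (∀ e → lookup E' e ≡ true → 0# ≤ f e)
                × (∀ v → load E' f v ≤ b v)

  IsNuStar : Subset m → Carrier → Set c
  IsNuStar E' μ = (∃ λ f → Feasible E' f × value E' f ≡ μ)
                × (∀ f → Feasible E' f → value E' f ≤ μ)

-- Simplicial complexes on vertex set Fin m, given as predicates on faces,
-- and d-collapsibility.

module _ {ℓ : Level} {m : ℕ} where

  IsFacet : (Subset m → Set ℓ) → Subset m → Set ℓ
  IsFacet X F = X F × (∀ G → X G → F ⊆ G → G ≡ F)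

  UniqueFacet : (Subset m → Set ℓ) → Subset m → Set ℓ
  UniqueFacet X σ = ∃ λ F → (IsFacet X F × σ ⊆ F)
                          × (∀ G → IsFacet X G → σ ⊆ G → G ≡ F)

  data Collapsible (d : ℕ) (X : Subset m → Set ℓ) : Set ℓ where
    done : (∀ τ → X τ ⇔ (τ ≡ ⊥)) → Collapsible d X
    step : (σ : Subset m) → X σ → UniqueFacet X σ →
           ∣ σ ∣ Data.Nat.≤ d →
           Collapsible d (λ τ → X τ × ¬ (σ ⊆ τ)) →
           Collapsible d X

{-# OPTIONS --safe #-}

-- By linear programming duality, ν* E' < n iff E' has a fractional cover of
-- total weight below n, so a and b can be increased slightly, within the
-- finitely many strict inequalities that witness the faces, without changing
-- X.  For generic a and b every E' has a unique optimal matching f and a unique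
-- optimal cover w; hence the sets with a given optimal pair form an interval
-- [ supp f , { e covered by w } ] on which ν* is constant, and these intervals
-- are collapsed in order of decreasing ν*.  Genericity also gives
-- |supp f| ≤ |supp w|, and every vertex of supp w is saturated by f, whence
-- |supp w| · min b ≤ r · Σ f ≤ r · ν* / min a.
module Submission where

open import Defs
open import Data.Bool using (true; false; if_then_else_)
open import Data.Bool.Properties using () renaming (_≟_ to _≟ᵇ_)
open import Data.Nat using (ℕ; zero; suc) renaming (_≤_ to _≤ℕ_)
import Data.Nat as ℕ
import Data.Nat.Properties as ℕ
import Data.Integer as ℤ
import Data.Integer.Properties as ℤ
open import Data.Fin using (Fin; zero; suc)
import Data.Fin as Fin
import Data.Fin.Properties as Fin
open import Data.Fin.Subset using (Subset; ∣_∣; _⊆_; inside; outside; ⊥; _∈_; _∉_) renaming (_-_ to _∖_)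
import Data.Fin.Subset.Properties as Subset
open import Data.Vec using ([]; _∷_; here; there; lookup; tabulate)
open import Data.Vec.Properties using (≡-dec; lookup∘tabulate; tabulate-cong; lookup⇒[]=; []=⇒lookup)
open import Data.List using (List; []; _∷_; _++_; map; length; filter; allFin; cartesianProduct; cartesianProductWith)
open import Data.List.Properties using (filter-notAll)
import Data.List.Extrema
open import Data.List.Relation.Unary.All as All using (All; []; _∷_)
import Data.List.Relation.Unary.All.Properties as All
import Data.List.Relation.Unary.Any as Any
open import Data.List.Membership.Propositional using () renaming (_∈_ to _∈ᴸ_)
open import Data.List.Membership.Propositional.Properties
  using (∈-map⁺; ∈-++⁺ˡ; ∈-++⁺ʳ; ∈-filter⁺; ∈-cartesianProductWith⁺; ∈-cartesianProduct⁺; ∈-allFin)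
open import Data.Maybe using (just; nothing)
open import Data.Product using (∃; Σ-syntax; _×_; _,_; proj₁; proj₂)
open import Data.Sum using (_⊎_; inj₁; inj₂)
open import Function using (_∘_; mk⇔)
open import Function.Definitions using (Injective)
open import Level using (Level) renaming (suc to lsuc)
open import Relation.Nullary using (¬_; Dec; does; yes; no; contradiction; ¬?)
open import Relation.Nullary.Decidable using (_×-dec_; _⊎-dec_; decidable-stable; dec-true; map′)
open import Relation.Unary using (Decidable)
open import Relation.Binary.Bundles using (StrictPartialOrder; TotalOrder)
open import Relation.Binary.Definitions using (DecidableEquality; WeaklyDecidable; tri<; tri≈; tri>)
open import Relation.Binary.Structures using (IsStrictTotalOrder; IsDecTotalOrder)
open import Relation.Binary.PropositionalEquality
  using (_≡_; _≢_; refl; sym; trans; cong; cong₂; subst; subst₂)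
open import Algebra.Bundles using (CommutativeRing)
import Algebra.Properties.Ring
import Algebra.Properties.Semiring.Sum
import Algebra.Properties.Semiring.Mult.TCOptimised
import Algebra.Solver.Ring
import Algebra.Solver.Ring.AlmostCommutativeRing as ACR
import Relation.Binary.Construct.StrictToNonStrict as StrictToNonStrict
import Relation.Binary.Reasoning.StrictPartialOrder

-- In general neither the optimal matching nor the optimal cover is unique, and then no canonical
-- smallest face or facet belongs to E'; this obstacle forces the perturbation. Weights are only
-- increased: lower bounds by the old minima persist, and ν* can only grow, so one inclusion between
-- the two complexes is immediate. For the other, each face gets in advance a cover with strict
-- inequalities. Those at the edges involve only a, the one on the total weight only b, so a and b
-- can be perturbed independently.
--
-- Genericity is linear algebra: for every choice S of rows and σ of columns of the incidence matrix
-- (or its transpose), either the submatrix has trivial kernel or some kernel vector is not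
-- orthogonal to the weights. Complementary slackness writes the weights on σ as a combination of
-- the rows in S, hence orthogonal to the kernel, so the kernel is trivial. This yields both
-- uniqueness and the inequality between the supports.
--
-- Strong duality comes from eliminating the unknowns f while a lower bound z on the value stays a
-- parameter: the surviving constraints bound z, and the tightest one is an optimal cover up to
-- scaling.

allSubsets : ∀ m → List (Subset m)
allSubsets zero    = [] ∷ []
allSubsets (suc m) = map (inside ∷_) (allSubsets m) ++ map (outside ∷_) (allSubsets m)

∈-allSubsets : ∀ {m} (σ : Subset m) → σ ∈ᴸ allSubsets m
∈-allSubsets []            = Any.here refl
∈-allSubsets (inside ∷ σ)  = ∈-++⁺ˡ (∈-map⁺ (inside ∷_) (∈-allSubsets σ))
∈-allSubsets (outside ∷ σ) = ∈-++⁺ʳ _ (∈-map⁺ (outside ∷_) (∈-allSubsets σ))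

_≟ˢ_ : ∀ {m} → DecidableEquality (Subset m)
_≟ˢ_ = ≡-dec _≟ᵇ_

-- Collapsing a complex that is partitioned into intervals.

-- The fibres of (B , C) are the intervals [ B τ , C τ ], and ν is constant on
-- them.  A face τ with ν τ maximal can therefore be removed together with its
-- interval: C τ is the only facet above B τ.
module IntervalCollapse
  {o₁ o₂ o₃} (O : TotalOrder o₁ o₂ o₃) {m : ℕ}
  (ν : Subset m → TotalOrder.Carrier O)
  (B C : Subset m → Subset m)
  (ν-mono : ∀ {σ τ} → σ ⊆ τ → TotalOrder._≤_ O (ν σ) (ν τ))
  (B⊆ : ∀ τ → B τ ⊆ τ) (⊆C : ∀ τ → τ ⊆ C τ)
  (ν-B : ∀ τ → TotalOrder._≈_ O (ν (B τ)) (ν τ))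
  (ν-C : ∀ τ → TotalOrder._≈_ O (ν (C τ)) (ν τ))
  (fibre : ∀ {σ τ} → σ ⊆ τ → TotalOrder._≈_ O (ν σ) (ν τ) → B σ ≡ B τ × C σ ≡ C τ)
  (B-⊥ : ∀ τ → B τ ≡ ⊥ → τ ≡ ⊥)
  where
  open TotalOrder O using () renaming (_≤_ to _≼_; _≈_ to _≋_)
  private module O = TotalOrder O
  open Data.List.Extrema O using (argmax; argmax-all; f[xs]≤f[argmax])

  module _ {ℓ : Level} {d : ℕ} where

    -- `closed` is the invariant that survives every collapse: together with `down` it keeps the
    -- complex a union of whole intervals, so that `C` still produces facets. `small` bounds the
    -- sets used as `σ` in the collapses.
    record Complex (X : Subset m → Set ℓ) : Set ℓ where
      field
        dec    : ∀ τ → Dec (X τ)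
        empty  : X ⊥
        down   : ∀ {σ τ} → σ ⊆ τ → X τ → X σ
        closed : ∀ {τ} → X τ → X (C τ)
        small  : ∀ {τ} → X τ → ∣ B τ ∣ ≤ℕ d

    -- Induction over a list containing all remaining faces: each elementary collapse deletes `σ`
    -- from it, so its length, bounded by `fuel`, drops.
    collapse : ∀ {X} → Complex X → (fuel : ℕ) (candidates : List (Subset m)) →
               length candidates ≤ℕ fuel → (∀ {τ} → X τ → τ ∈ᴸ candidates) → Collapsible d X
    collapse {X} K fuel L L≤fuel X⊆L = remove (σ ≟ˢ ⊥)
      where
      open Complex K
      top σ : Subset m
      -- `⊥` is the default value of `argmax`; it is itself a face, so `top` is a face in every
      -- case.
      top = argmax ν ⊥ (filter dec L)
      σ = B top

      X-top : X top
      X-top = argmax-all ν empty (All.all-filter dec L)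

      ν≤ν-top : ∀ {τ} → X τ → ν τ ≼ ν top
      ν≤ν-top Xτ = All.lookup (f[xs]≤f[argmax] {f = ν} ⊥ (filter dec L)) (∈-filter⁺ dec (X⊆L Xτ) Xτ)

      Xσ : X σ
      Xσ = down (B⊆ top) X-top

      -- Squeezed by ν σ ≤ ν τ ≤ ν top = ν σ, by monotonicity and the choice of `top`.
      ν-above : ∀ {τ} → X τ → σ ⊆ τ → ν σ ≋ ν τ
      ν-above Xτ σ⊆τ = O.antisym (ν-mono σ⊆τ) (O.trans (ν≤ν-top Xτ) (O.reflexive (O.Eq.sym (ν-B top))))

      B-above : ∀ {τ} → X τ → σ ⊆ τ → B τ ≡ σ
      B-above Xτ σ⊆τ = trans (sym (proj₁ (fibre σ⊆τ (ν-above Xτ σ⊆τ)))) (proj₁ (fibre (B⊆ top) (ν-B top)))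

      above⊆C : ∀ {τ} → X τ → σ ⊆ τ → τ ⊆ C σ
      above⊆C {τ} Xτ σ⊆τ x∈τ = subst (_ ∈_) (sym (proj₂ (fibre σ⊆τ (ν-above Xτ σ⊆τ)))) (⊆C τ x∈τ)

      XCσ : X (C σ)
      XCσ = closed Xσ

      unique : UniqueFacet X σ
      unique = C σ
        , ((XCσ , λ G XG Cσ⊆G → Subset.⊆-antisym (above⊆C XG (Cσ⊆G ∘ ⊆C σ)) Cσ⊆G) , ⊆C σ)
        , λ G (XG , max) σ⊆G → sym (max (C σ) XCσ (above⊆C XG σ⊆G))

      smaller : σ ≢ ⊥ → Complex (λ τ → X τ × ¬ σ ⊆ τ)
      smaller σ≢⊥ = record
        { dec    = λ τ → dec τ ×-dec ¬? (σ Subset.⊆? τ)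
        ; empty  = empty , λ σ⊆⊥ → σ≢⊥ (Subset.⊆-antisym σ⊆⊥ (Subset.⊆-min σ))
        ; down   = λ ρ⊆τ (Xτ , σ⊈τ) → down ρ⊆τ Xτ , λ σ⊆ρ → σ⊈τ (ρ⊆τ ∘ σ⊆ρ)
        -- If σ ⊆ C τ, then maximality puts C τ into the interval of σ; since τ and C τ share the
        -- same `B`, this gives σ = B τ ⊆ τ.
        ; closed = λ {τ} (Xτ , σ⊈τ) → closed Xτ , λ σ⊆Cτ →
            σ⊈τ (subst (_⊆ τ)
                   (trans (proj₁ (fibre (⊆C τ) (O.Eq.sym (ν-C τ)))) (B-above (closed Xτ) σ⊆Cτ))
                   (B⊆ τ))
        ; small  = small ∘ proj₁
        }

      remove : Dec (σ ≡ ⊥) → Collapsible d X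
      -- Every face lies above the empty set, hence has empty `B` and is empty.
      remove (yes σ≡⊥) = done λ τ → mk⇔
        (λ Xτ → B-⊥ τ (trans (B-above Xτ (subst (_⊆ τ) (sym σ≡⊥) (Subset.⊆-min τ))) σ≡⊥))
        (λ { refl → empty })
      remove (no σ≢⊥) = step σ Xσ unique (small X-top) (shrink fuel L≤fuel)
        where
        L′ = filter (λ τ → ¬? (τ ≟ˢ σ)) L

        L′<L : length L′ ℕ.< length L
        L′<L = filter-notAll (λ τ → ¬? (τ ≟ˢ σ)) L (Any.map (λ σ≡τ τ≢σ → τ≢σ (sym σ≡τ)) (X⊆L Xσ))

        shrink : ∀ fuel → length L ≤ℕ fuel → Collapsible d (λ τ → X τ × ¬ σ ⊆ τ)
        shrink zero       L≤0    = contradiction (ℕ.<-≤-trans L′<L L≤0) λ ()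
        shrink (suc fuel) L≤fuel = collapse (smaller σ≢⊥) fuel L′ (ℕ.≤-pred (ℕ.≤-trans L′<L L≤fuel))
          λ (Xτ , σ⊈τ) → ∈-filter⁺ _ (X⊆L Xτ) λ { refl → σ⊈τ (λ x∈ → x∈) }

    collapsible : ∀ {X} → Complex X → Collapsible d X
    collapsible K = collapse K _ (allSubsets m) ℕ.≤-refl (λ {τ} _ → ∈-allSubsets τ)

comprehension : ∀ {n ℓ} {P : Fin n → Set ℓ} → Decidable P → Subset n
comprehension P? = tabulate (does ∘ P?)

∈-comprehension⁺ : ∀ {n ℓ} {P : Fin n → Set ℓ} (P? : Decidable P) {i} → P i → i ∈ comprehension P?
∈-comprehension⁺ P? {i} p = lookup⇒[]= i _ (trans (lookup∘tabulate (does ∘ P?) i) (dec-true (P? i) p))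

∈-comprehension⁻ : ∀ {n ℓ} {P : Fin n → Set ℓ} (P? : Decidable P) {i} → i ∈ comprehension P? → P i
∈-comprehension⁻ P? {i} i∈ with P? i | trans (sym (lookup∘tabulate (does ∘ P?) i)) ([]=⇒lookup i∈)
... | yes p | _  = p
... | no  _ | ()

-- Ring normalisation with integer coefficients.

-- The standard ring solver only cancels x - x if equality of coefficients
-- computes, hence the coefficients are taken in ℤ.
module IntegerCoefficients {c ℓ} (R : CommutativeRing c ℓ) where
  open import Data.Integer using (ℤ; +_; -[1+_])
  open CommutativeRing R renaming (refl to ≈-refl; sym to ≈-sym; trans to ≈-trans)
  open Algebra.Properties.Ring ring
  open Algebra.Properties.Semiring.Mult.TCOptimised semiring renaming (_×_ to _·_)
  open import Relation.Binary.Reasoning.Setoid setoid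

  fromℤ : ℤ → Carrier
  fromℤ (+ n)    = n · 1#
  fromℤ -[1+ n ] = - (suc n · 1#)

  fromℤ-⊖ : ∀ m n → fromℤ (m ℤ.⊖ n) ≈ m · 1# - n · 1#
  fromℤ-⊖ m       zero    = begin
    m · 1#       ≈⟨ +-identityʳ _ ⟨
    m · 1# + 0#  ≈⟨ +-congˡ -0#≈0# ⟨
    m · 1# - 0#  ∎
  fromℤ-⊖ zero    (suc n) = ≈-sym (+-identityˡ _)
  fromℤ-⊖ (suc m) (suc n) = begin
    fromℤ (suc m ℤ.⊖ suc n)              ≡⟨ cong fromℤ (ℤ.[1+m]⊖[1+n]≡m⊖n m n) ⟩
    fromℤ (m ℤ.⊖ n)                      ≈⟨ fromℤ-⊖ m n ⟩
    m · 1# - n · 1#                      ≈⟨ +-congˡ (+-identityˡ _) ⟨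
    m · 1# + (0# - n · 1#)               ≈⟨ +-congˡ (+-congʳ (-‿inverseʳ 1#)) ⟨
    m · 1# + ((1# - 1#) - n · 1#)        ≈⟨ +-congˡ (+-assoc _ _ _) ⟩
    m · 1# + (1# + (- 1# - n · 1#))      ≈⟨ +-assoc _ _ _ ⟨
    (m · 1# + 1#) + (- 1# - n · 1#)      ≈⟨ +-cong (+-comm _ _) (-‿+-comm 1# (n · 1#)) ⟩
    (1# + m · 1#) - (1# + n · 1#)        ≈⟨ +-cong (1+× m 1#) (-‿cong (1+× n 1#)) ⟨
    suc m · 1# - suc n · 1#              ∎

  fromℤ-+ : ∀ i j → fromℤ (i ℤ.+ j) ≈ fromℤ i + fromℤ j
  fromℤ-+ (+ m)    (+ n)    = ×-homo-+ 1# m n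
  fromℤ-+ (+ m)    -[1+ n ] = fromℤ-⊖ m (suc n)
  fromℤ-+ -[1+ m ] (+ n)    = ≈-trans (fromℤ-⊖ n (suc m)) (+-comm _ _)
  fromℤ-+ -[1+ m ] -[1+ n ] = begin
    - (suc (suc (m ℕ.+ n)) · 1#)       ≡⟨ cong (λ k → - (k · 1#)) (sym (ℕ.+-suc (suc m) n)) ⟩
    - ((suc m ℕ.+ suc n) · 1#)         ≈⟨ -‿cong (×-homo-+ 1# (suc m) (suc n)) ⟩
    - (suc m · 1# + suc n · 1#)        ≈⟨ -‿+-comm _ _ ⟨
    - (suc m · 1#) - suc n · 1#        ∎

  fromℤ-neg : ∀ i → fromℤ (ℤ.- i) ≈ - fromℤ i
  fromℤ-neg (+ zero)  = ≈-sym -0#≈0#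
  fromℤ-neg (+ suc n) = ≈-refl
  fromℤ-neg -[1+ n ]  = ≈-sym (-‿involutive _)

  fromℤ-* : ∀ i j → fromℤ (i ℤ.* j) ≈ fromℤ i * fromℤ j
  fromℤ-*-pos : ∀ m j → fromℤ (+ m ℤ.* j) ≈ fromℤ (+ m) * fromℤ j
  fromℤ-*-pos m (+ n) = begin
    fromℤ (+ m ℤ.* + n)  ≡⟨ cong fromℤ (sym (ℤ.pos-* m n)) ⟩
    (m ℕ.* n) · 1#       ≈⟨ ×1-homo-* m n ⟩
    (m · 1#) * (n · 1#)  ∎
  fromℤ-*-pos m -[1+ n ] = begin
    fromℤ (+ m ℤ.* (ℤ.- + suc n))    ≡⟨ cong fromℤ (sym (ℤ.neg-distribʳ-* (+ m) (+ suc n))) ⟩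
    fromℤ (ℤ.- (+ m ℤ.* + suc n))    ≈⟨ fromℤ-neg (+ m ℤ.* + suc n) ⟩
    - fromℤ (+ m ℤ.* + suc n)        ≈⟨ -‿cong (fromℤ-*-pos m (+ suc n)) ⟩
    - (m · 1# * (suc n · 1#))        ≈⟨ -‿distribʳ-* _ _ ⟩
    m · 1# * - (suc n · 1#)          ∎
  fromℤ-* (+ m) j = fromℤ-*-pos m j
  fromℤ-* -[1+ m ] j = begin
    fromℤ (ℤ.- + suc m ℤ.* j)        ≡⟨ cong fromℤ (sym (ℤ.neg-distribˡ-* (+ suc m) j)) ⟩
    fromℤ (ℤ.- (+ suc m ℤ.* j))      ≈⟨ fromℤ-neg (+ suc m ℤ.* j) ⟩
    - fromℤ (+ suc m ℤ.* j)          ≈⟨ -‿cong (fromℤ-*-pos (suc m) j) ⟩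
    - (suc m · 1# * fromℤ j)         ≈⟨ -‿distribˡ-* _ _ ⟩
    - (suc m · 1#) * fromℤ j         ∎

  almostCommutativeRing : ACR.AlmostCommutativeRing c ℓ
  almostCommutativeRing = ACR.fromCommutativeRing R

  morphism : ℤ.+-*-rawRing ACR.-Raw-AlmostCommutative⟶ almostCommutativeRing
  morphism = record
    { ⟦_⟧    = fromℤ
    ; +-homo = fromℤ-+
    ; *-homo = fromℤ-*
    ; -‿homo = fromℤ-neg
    ; 0-homo = ≈-refl
    ; 1-homo = ≈-refl
    }

  coefficient≟ : WeaklyDecidable (ACR.Induced-equivalence morphism)
  coefficient≟ i j with i ℤ.≟ j
  ... | yes i≡j = just (reflexive (cong fromℤ i≡j))
  ... | no  _   = nothing

  open Algebra.Solver.Ring ℤ.+-*-rawRing almostCommutativeRing morphism coefficient≟ public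
    using (Polynomial; solve; _:=_; _:+_; _:*_; _:-_; :-_; con)

  :0 :1 : ∀ {n} → Polynomial n
  :0 = con (+ 0)
  :1 = con (+ 1)

-- Ordered-field arithmetic and finite sums.

module OverRealField {c} (R : RealField c) where
  open RealField R public
  open IsStrictTotalOrder isStrictTotalOrder public
    using (compare; _<?_) renaming (trans to <-trans; irrefl to <-irrefl; asym to <-asym)

  commutativeRing : CommutativeRing c c
  commutativeRing = record { isCommutativeRing = isCommutativeRing }

  open CommutativeRing commutativeRing public
    using (semiring; _-_; +-comm; +-identityˡ; +-identityʳ; *-assoc; *-comm;
           *-identityˡ; *-identityʳ; zeroˡ; zeroʳ; -‿inverseʳ)
  open Algebra.Properties.Semiring.Sum semiring public
    using (sum; sum-cong-≗; ∑-comm; ∑-distrib-+; *-distribˡ-sum; *-distribʳ-sum; sum-replicate-zero)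
  open IntegerCoefficients commutativeRing public
    using (solve; _:=_; _:+_; _:*_; _:-_; :-_; :0; :1)
  open StrictToNonStrict _≡_ _<_ using () renaming (isDecTotalOrder to decTotal)
  open IsDecTotalOrder (decTotal isStrictTotalOrder) public
    using (_≤?_; _≟_; isTotalOrder) renaming (refl to ≤-refl; trans to ≤-trans; antisym to ≤-antisym)

  strictPartialOrder : StrictPartialOrder c c c
  strictPartialOrder = record
    { isStrictPartialOrder = IsStrictTotalOrder.isStrictPartialOrder isStrictTotalOrder }

  module ≤-Reasoning = Relation.Binary.Reasoning.StrictPartialOrder strictPartialOrder
  open ≤-Reasoning

  <⇒≤ : ∀ {x y} → x < y → x ≤ y
  <⇒≤ = inj₁

  ≮⇒≥ : ∀ {x y} → ¬ x < y → y ≤ x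
  ≮⇒≥ {x} {y} x≮y with compare x y
  ... | tri< x<y _ _ = contradiction x<y x≮y
  ... | tri≈ _ x≡y _ = inj₂ (sym x≡y)
  ... | tri> _ _ y<x = inj₁ y<x

  ≰⇒> : ∀ {x y} → ¬ x ≤ y → y < x
  ≰⇒> {x} {y} x≰y with compare x y
  ... | tri< x<y _ _ = contradiction (inj₁ x<y) x≰y
  ... | tri≈ _ x≡y _ = contradiction (inj₂ x≡y) x≰y
  ... | tri> _ _ y<x = y<x

  <⇒≱ : ∀ {x y} → x < y → ¬ y ≤ x
  <⇒≱ x<y (inj₁ y<x) = <-asym x<y y<x
  <⇒≱ x<y (inj₂ y≡x) = <-irrefl (sym y≡x) x<y

  <-≤-trans : ∀ {x y z} → x < y → y ≤ z → x < z
  <-≤-trans {x} {y} {z} x<y y≤z = begin-strict x <⟨ x<y ⟩ y ≤⟨ y≤z ⟩ z ∎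

  ≤-<-trans : ∀ {x y z} → x ≤ y → y < z → x < z
  ≤-<-trans {x} {y} {z} x≤y y<z = begin-strict x ≤⟨ x≤y ⟩ y <⟨ y<z ⟩ z ∎

  +-monoˡ-≤ : ∀ {x y} z → x ≤ y → x + z ≤ y + z
  +-monoˡ-≤ z (inj₁ x<y)  = inj₁ (+-mono-< z x<y)
  +-monoˡ-≤ z (inj₂ refl) = ≤-refl

  +-mono-≤ : ∀ {x y u v} → x ≤ y → u ≤ v → x + u ≤ y + v
  +-mono-≤ {x} {y} {u} {v} x≤y u≤v = begin
    x + u  ≤⟨ +-monoˡ-≤ u x≤y ⟩
    y + u  ≡⟨ +-comm y u ⟩
    u + y  ≤⟨ +-monoˡ-≤ y u≤v ⟩
    v + y  ≡⟨ +-comm v y ⟩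
    y + v  ∎

  +-nonneg : ∀ {x y} → 0# ≤ x → 0# ≤ y → 0# ≤ x + y
  +-nonneg {x} {y} 0≤x 0≤y = subst (_≤ x + y) (+-identityˡ 0#) (+-mono-≤ 0≤x 0≤y)

  x<y⇒0<y-x : ∀ {x y} → x < y → 0# < y - x
  x<y⇒0<y-x {x} {y} x<y = subst (_< y - x) (-‿inverseʳ x) (+-mono-< (- x) x<y)

  0<y-x⇒x<y : ∀ {x y} → 0# < y - x → x < y
  0<y-x⇒x<y {x} {y} 0<d = begin-strict
    x            ≡⟨ +-identityˡ x ⟨
    0# + x       <⟨ +-mono-< x 0<d ⟩
    y - x + x    ≡⟨ solve 2 (λ x y → y :- x :+ x := y) refl x y ⟩
    y            ∎

  x≤y⇒0≤y-x : ∀ {x y} → x ≤ y → 0# ≤ y - x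
  x≤y⇒0≤y-x (inj₁ x<y)     = inj₁ (x<y⇒0<y-x x<y)
  x≤y⇒0≤y-x {x} (inj₂ refl) = inj₂ (sym (-‿inverseʳ x))

  0≤y-x⇒x≤y : ∀ {x y} → 0# ≤ y - x → x ≤ y
  0≤y-x⇒x≤y {x} {y} 0≤d = ≮⇒≥ λ y<x → <⇒≱ (x<y⇒0<y-x y<x) (begin
    x - y         ≡⟨ +-identityˡ _ ⟨
    0# + (x - y)  ≤⟨ +-monoˡ-≤ (x - y) 0≤d ⟩
    y - x + (x - y) ≡⟨ solve 2 (λ x y → y :- x :+ (x :- y) := :0) refl x y ⟩
    0#            ∎)

  x-y≡0⇒x≡y : ∀ {x y} → x - y ≡ 0# → x ≡ y
  x-y≡0⇒x≡y {x} {y} x-y≡0 = begin-equality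
    x          ≡⟨ solve 2 (λ x y → x := x :- y :+ y) refl x y ⟩
    x - y + y  ≡⟨ cong (_+ y) x-y≡0 ⟩
    0# + y     ≡⟨ +-identityˡ y ⟩
    y          ∎

  *-nonneg : ∀ {x y} → 0# ≤ x → 0# ≤ y → 0# ≤ x * y
  *-nonneg         (inj₁ 0<x)  (inj₁ 0<y)  = inj₁ (*-pos 0<x 0<y)
  *-nonneg {x} {y} (inj₁ _)    (inj₂ refl) = inj₂ (sym (zeroʳ x))
  *-nonneg {x} {y} (inj₂ refl) _           = inj₂ (sym (zeroˡ y))

  *-monoʳ-≤ : ∀ {x y z} → 0# ≤ z → x ≤ y → z * x ≤ z * y
  *-monoʳ-≤ {x} {y} {z} 0≤z x≤y = 0≤y-x⇒x≤y (subst (0# ≤_)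
    (solve 3 (λ x y z → z :* (y :- x) := z :* y :- z :* x) refl x y z)
    (*-nonneg 0≤z (x≤y⇒0≤y-x x≤y)))

  *-monoˡ-≤ : ∀ {x y z} → 0# ≤ z → x ≤ y → x * z ≤ y * z
  *-monoˡ-≤ {x} {y} {z} 0≤z x≤y =
    subst (_≤ y * z) (*-comm z x) (subst (z * x ≤_) (*-comm z y) (*-monoʳ-≤ 0≤z x≤y))

  *-monoʳ-< : ∀ {x y z} → 0# < z → x < y → z * x < z * y
  *-monoʳ-< {x} {y} {z} 0<z x<y = 0<y-x⇒x<y (subst (0# <_)
    (solve 3 (λ x y z → z :* (y :- x) := z :* y :- z :* x) refl x y z)
    (*-pos 0<z (x<y⇒0<y-x x<y)))

  *-cancelˡ-≤ : ∀ {x y z} → 0# < z → z * x ≤ z * y → x ≤ y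
  *-cancelˡ-≤ 0<z zx≤zy = ≮⇒≥ λ y<x → <⇒≱ (*-monoʳ-< 0<z y<x) zx≤zy

  neg-pos : ∀ {x} → x < 0# → 0# < - x
  neg-pos {x} x<0 = subst (0# <_) (+-identityˡ _) (x<y⇒0<y-x x<0)

  0<1 : 0# < 1#
  0<1 with compare 0# 1#
  ... | tri< 0<1 _ _ = 0<1
  ... | tri≈ _ 0≡1 _ = contradiction 0≡1 0≢1
  ... | tri> _ _ 1<0 = subst (0# <_) (solve 0 (:- :1 :* :- :1 := :1) refl)
                             (*-pos (neg-pos 1<0) (neg-pos 1<0))

  <⇒≢ : ∀ {x y} → x < y → y ≢ x
  <⇒≢ x<y y≡x = <-irrefl (sym y≡x) x<y

  *-zero-product : ∀ {x y} → x ≢ 0# → x * y ≡ 0# → y ≡ 0#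
  *-zero-product {x} {y} x≢0 xy≡0 with x⁻¹ , xx⁻¹≡1 ← inverse x x≢0 = begin-equality
    y              ≡⟨ *-identityˡ y ⟨
    1# * y         ≡⟨ cong (_* y) xx⁻¹≡1 ⟨
    x * x⁻¹ * y    ≡⟨ solve 3 (λ x i y → x :* i :* y := i :* (x :* y)) refl x x⁻¹ y ⟩
    x⁻¹ * (x * y)  ≡⟨ cong (x⁻¹ *_) xy≡0 ⟩
    x⁻¹ * 0#       ≡⟨ zeroʳ x⁻¹ ⟩
    0#             ∎

  inverse-pos : ∀ {x} → 0# < x → ∃ λ y → 0# < y × x * y ≡ 1#
  inverse-pos {x} 0<x with y , xy≡1 ← inverse x (<⇒≢ 0<x) = y , ≰⇒> y≰0 , xy≡1
    where
    y≰0 : ¬ y ≤ 0#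
    y≰0 y≤0 = <⇒≱ 0<1 (begin
      1#      ≡⟨ xy≡1 ⟨
      x * y   ≤⟨ *-monoʳ-≤ (<⇒≤ 0<x) y≤0 ⟩
      x * 0#  ≡⟨ zeroʳ x ⟩
      0#      ∎)

  nonneg∧≢0⇒pos : ∀ {x} → 0# ≤ x → x ≢ 0# → 0# < x
  nonneg∧≢0⇒pos (inj₁ 0<x) _   = 0<x
  nonneg∧≢0⇒pos (inj₂ 0≡x) x≢0 = contradiction (sym 0≡x) x≢0

  fromℕ-nonneg : ∀ k → 0# ≤ fromℕ k
  fromℕ-nonneg zero    = ≤-refl
  fromℕ-nonneg (suc k) = +-nonneg (<⇒≤ 0<1) (fromℕ-nonneg k)

  fromℕ-suc-pos : ∀ k → 0# < fromℕ (suc k)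
  fromℕ-suc-pos k = begin-strict
    0#            <⟨ 0<1 ⟩
    1#            ≡⟨ +-identityʳ 1# ⟨
    1# + 0#       ≤⟨ +-mono-≤ ≤-refl (fromℕ-nonneg k) ⟩
    1# + fromℕ k  ∎

  fromℕ-mono-≤ : ∀ {j k} → j ≤ℕ k → fromℕ j ≤ fromℕ k
  fromℕ-mono-≤ {k = k} ℕ.z≤n = fromℕ-nonneg k
  fromℕ-mono-≤ (ℕ.s≤s j≤k)   = +-mono-≤ ≤-refl (fromℕ-mono-≤ j≤k)

  sumFin≡sum : ∀ n g → sumFin n g ≡ sum g
  sumFin≡sum zero    g = refl
  sumFin≡sum (suc n) g = cong (g zero +_) (sumFin≡sum n (g ∘ suc))

  sum-mono : ∀ {n} {g h : Fin n → Carrier} → (∀ i → g i ≤ h i) → sum g ≤ sum h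
  sum-mono {zero}  g≤h = ≤-refl
  sum-mono {suc n} g≤h = +-mono-≤ (g≤h zero) (sum-mono (g≤h ∘ suc))

  sum-zero : ∀ {n} {g : Fin n → Carrier} → (∀ i → g i ≡ 0#) → sum g ≡ 0#
  sum-zero {n} g≡0 = trans (sum-cong-≗ g≡0) (sum-replicate-zero n)

  sum-nonneg : ∀ {n} {g : Fin n → Carrier} → (∀ i → 0# ≤ g i) → 0# ≤ sum g
  sum-nonneg {n} {g} 0≤g = subst (_≤ sum g) (sum-replicate-zero n) (sum-mono 0≤g)

  -- This is what turns equality in weak duality into complementary slackness.
  sum-mono-tight : ∀ {n} {g h : Fin n → Carrier} → (∀ i → g i ≤ h i) → sum g ≡ sum h → ∀ i → g i ≡ h i
  sum-mono-tight {suc n} {g} {h} g≤h Σg≡Σh = λ { zero → g₀≡h₀ ; (suc i) → sum-mono-tight (g≤h ∘ suc) tails i }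
    where
    g₀≡h₀ : g zero ≡ h zero
    g₀≡h₀ with g≤h zero
    ... | inj₂ eq = eq
    ... | inj₁ lt = contradiction Σg≡Σh (<⇒≢ (begin-strict
            sum g                         <⟨ +-mono-< _ lt ⟩
            h zero + sum (g ∘ suc)        ≤⟨ +-mono-≤ ≤-refl (sum-mono (g≤h ∘ suc)) ⟩
            sum h                         ∎) ∘ sym)
    tails : sum (g ∘ suc) ≡ sum (h ∘ suc)
    tails = begin-equality
      sum (g ∘ suc)                     ≡⟨ solve 2 (λ x y → y := x :+ y :- x) refl (g zero) _ ⟩
      sum g - g zero                    ≡⟨ cong₂ _-_ Σg≡Σh g₀≡h₀ ⟩
      sum h - h zero                    ≡⟨ solve 2 (λ x y → y := x :+ y :- x) refl (h zero) _ ⟨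
      sum (h ∘ suc)                     ∎

  term≤sum : ∀ {n} {g : Fin n → Carrier} → (∀ i → 0# ≤ g i) → ∀ i → g i ≤ sum g
  term≤sum {g = g} 0≤g zero    = subst (_≤ sum g) (+-identityʳ (g zero)) (+-mono-≤ ≤-refl (sum-nonneg (0≤g ∘ suc)))
  term≤sum {g = g} 0≤g (suc i) =
    subst (_≤ sum g) (+-identityˡ (g (suc i))) (+-mono-≤ (0≤g zero) (term≤sum (0≤g ∘ suc) i))

  -- Vectors, dot products and adjoint matrices.

  module LinearAlgebra where

    infixl 8 _·_
    _·_ : ∀ {n} → (Fin n → Carrier) → (Fin n → Carrier) → Carrier
    f · g = sum λ i → f i * g i

    ·-comm : ∀ {n} (f g : Fin n → Carrier) → f · g ≡ g · f
    ·-comm f g = sum-cong-≗ λ i → *-comm (f i) (g i)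

    ·-congˡ : ∀ {n} {f g : Fin n → Carrier} h → (∀ i → f i ≡ g i) → f · h ≡ g · h
    ·-congˡ h f≡g = sum-cong-≗ λ i → cong (_* h i) (f≡g i)

    ·-linearˡ : ∀ {n} α β (f g x : Fin n → Carrier) →
                (λ i → α * f i + β * g i) · x ≡ α * (f · x) + β * (g · x)
    ·-linearˡ α β f g x = begin-equality
      sum (λ i → (α * f i + β * g i) * x i)
        ≡⟨ sum-cong-≗ (λ i → solve 5 (λ α β f g x → (α :* f :+ β :* g) :* x := α :* (f :* x) :+ β :* (g :* x))
                                   refl α β (f i) (g i) (x i)) ⟩
      sum (λ i → α * (f i * x i) + β * (g i * x i))
        ≡⟨ ∑-distrib-+ (λ i → α * (f i * x i)) _ ⟩
      sum (λ i → α * (f i * x i)) + sum (λ i → β * (g i * x i))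
        ≡⟨ cong₂ _+_ (sym (*-distribˡ-sum α (λ i → f i * x i))) (sym (*-distribˡ-sum β (λ i → g i * x i))) ⟩
      α * (f · x) + β * (g · x) ∎

    ·-linearʳ : ∀ {n} α β (x f g : Fin n → Carrier) →
                x · (λ i → α * f i + β * g i) ≡ α * (x · f) + β * (x · g)
    ·-linearʳ α β x f g = begin-equality
      x · (λ i → α * f i + β * g i)  ≡⟨ ·-comm x _ ⟩
      (λ i → α * f i + β * g i) · x  ≡⟨ ·-linearˡ α β f g x ⟩
      α * (f · x) + β * (g · x)      ≡⟨ cong₂ (λ s t → α * s + β * t) (·-comm f x) (·-comm g x) ⟩
      α * (x · f) + β * (x · g)      ∎

    ·-scaleʳ : ∀ {n} α (x f : Fin n → Carrier) → x · (λ i → α * f i) ≡ α * (x · f)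
    ·-scaleʳ α x f = trans
      (sum-cong-≗ λ i → solve 3 (λ α x f → x :* (α :* f) := α :* (x :* f)) refl α (x i) (f i))
      (sym (*-distribˡ-sum α (λ i → x i * f i)))

    ·-zeroʳ : ∀ {n} (x : Fin n → Carrier) → x · (λ _ → 0#) ≡ 0#
    ·-zeroʳ x = sum-zero λ i → zeroʳ (x i)

    ·-monoʳ : ∀ {n} {x f g : Fin n → Carrier} → (∀ i → 0# ≤ x i) → (∀ i → f i ≤ g i) → x · f ≤ x · g
    ·-monoʳ 0≤x f≤g = sum-mono λ i → *-monoʳ-≤ (0≤x i) (f≤g i)

    ·-nonneg : ∀ {n} {f g : Fin n → Carrier} → (∀ i → 0# ≤ f i) → (∀ i → 0# ≤ g i) → 0# ≤ f · g
    ·-nonneg 0≤f 0≤g = sum-nonneg λ i → *-nonneg (0≤f i) (0≤g i)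

    transpose : ∀ {p q} → (Fin p → Fin q → Carrier) → Fin q → Fin p → Carrier
    transpose A j i = A i j

    ·-adjoint : ∀ {p q} (A : Fin p → Fin q → Carrier) (x : Fin p → Carrier) (y : Fin q → Carrier) →
                x · (λ i → A i · y) ≡ y · (λ j → transpose A j · x)
    ·-adjoint A x y = begin-equality
      sum (λ i → x i * sum (λ j → A i j * y j))
        ≡⟨ sum-cong-≗ (λ i → *-distribˡ-sum (x i) (λ j → A i j * y j)) ⟩
      sum (λ i → sum (λ j → x i * (A i j * y j)))
        ≡⟨ ∑-comm (λ i j → x i * (A i j * y j)) ⟩
      sum (λ j → sum (λ i → x i * (A i j * y j)))
        ≡⟨ sum-cong-≗ (λ j → sum-cong-≗ λ i →
             solve 3 (λ x a y → x :* (a :* y) := y :* (a :* x)) refl (x i) (A i j) (y j)) ⟩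
      sum (λ j → sum (λ i → y j * (A i j * x i)))
        ≡⟨ sum-cong-≗ (λ j → sym (*-distribˡ-sum (y j) (λ i → A i j * x i))) ⟩
      sum (λ j → y j * sum (λ i → A i j * x i)) ∎

    δ : ∀ {n} → Fin n → Fin n → Carrier
    δ zero    zero    = 1#
    δ zero    (suc j) = 0#
    δ (suc i) zero    = 0#
    δ (suc i) (suc j) = δ i j

    δ-nonneg : ∀ {n} (i j : Fin n) → 0# ≤ δ i j
    δ-nonneg zero    zero    = <⇒≤ 0<1
    δ-nonneg zero    (suc j) = ≤-refl
    δ-nonneg (suc i) zero    = ≤-refl
    δ-nonneg (suc i) (suc j) = δ-nonneg i j

    δ-≢ : ∀ {n} {i j : Fin n} → i ≢ j → δ i j ≡ 0#
    δ-≢ {i = zero}  {zero}  i≢j = contradiction refl i≢j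
    δ-≢ {i = zero}  {suc j} i≢j = refl
    δ-≢ {i = suc i} {zero}  i≢j = refl
    δ-≢ {i = suc i} {suc j} i≢j = δ-≢ (i≢j ∘ cong suc)

    ·-δ : ∀ {n} (x : Fin n → Carrier) i → x · δ i ≡ x i
    ·-δ x zero = begin-equality
      x zero * 1# + sum (λ j → x (suc j) * 0#)  ≡⟨ cong₂ _+_ (*-identityʳ _) (·-zeroʳ (x ∘ suc)) ⟩
      x zero + 0#                               ≡⟨ +-identityʳ _ ⟩
      x zero                                    ∎
    ·-δ x (suc i) = begin-equality
      x zero * 0# + (x ∘ suc) · δ i  ≡⟨ cong₂ _+_ (zeroʳ _) (·-δ (x ∘ suc) i) ⟩
      0# + x (suc i)                 ≡⟨ +-identityˡ _ ⟩
      x (suc i)                      ∎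

    -- Solves for one unknown. A bound violated by the point found so far becomes the new point: it
    -- is tighter than the earlier bounds on its own side and respects the opposite ones by
    -- hypothesis.
    between : (ls us : List Carrier) → All (λ l → All (l ≤_) us) ls →
              ∃ λ x → All (_≤ x) ls × All (x ≤_) us
    between [] [] [] = 0# , [] , []
    between [] (u ∷ us) [] with between [] us []
    ... | x , [] , x≤us with x ≤? u
    ...   | yes x≤u = x , [] , x≤u ∷ x≤us
    ...   | no  x≰u = u , [] , ≤-refl ∷ All.map (≤-trans (<⇒≤ (≰⇒> x≰u))) x≤us
    between (l ∷ ls) us (l≤us ∷ ls≤us) with between ls us ls≤us
    ... | x , ls≤x , x≤us with l ≤? x
    ...   | yes l≤x = x , l≤x ∷ ls≤x , x≤us
    ...   | no  l≰x = l , ≤-refl ∷ All.map (λ y≤x → ≤-trans y≤x (<⇒≤ (≰⇒> l≰x))) ls≤x , l≤us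

  -- Fourier-Motzkin elimination with a parameter.

  module FourierMotzkin where
    open LinearAlgebra

    -- A convex cone K of linear inequalities  coef k · x ≤ bound k z  in the
    -- unknowns x, whose right-hand sides depend on a parameter z.
    record Inequalities (n : ℕ) : Set (lsuc c) where
      field
        K             : Set c
        coef          : K → Fin n → Carrier
        bound         : K → Carrier → Carrier
        combine       : ∀ {α β} → 0# < α → 0# < β → K → K → K
        coef-combine  : ∀ {α β} (0<α : 0# < α) (0<β : 0# < β) k l i →
                        coef (combine 0<α 0<β k l) i ≡ α * coef k i + β * coef l i
        bound-combine : ∀ {α β} (0<α : 0# < α) (0<β : 0# < β) k l z →
                        bound (combine 0<α 0<β k l) z ≡ α * bound k z + β * bound l z

      Holds : (Fin n → Carrier) → Carrier → K → Set c
      Holds x z k = coef k · x ≤ bound k z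

      Constant : Set c
      Constant = Σ[ k ∈ K ] ∀ i → coef k i ≡ 0#

    open Inequalities

    -- Positive combinations of inequalities free of the first unknown are again free of it.
    -- Elimination thus stays inside the original cone, and each derived inequality keeps the
    -- multipliers that prove it.
    withoutHead : ∀ {n} → Inequalities (suc n) → Inequalities n
    withoutHead I = record
      { K             = Σ[ k ∈ I.K ] I.coef k zero ≡ 0#
      ; coef          = λ (k , _) → I.coef k ∘ suc
      ; bound         = I.bound ∘ proj₁
      ; combine       = λ {α} {β} 0<α 0<β (k , k₀≡0) (l , l₀≡0) → I.combine 0<α 0<β k l , (begin-equality
          I.coef (I.combine 0<α 0<β k l) zero      ≡⟨ I.coef-combine 0<α 0<β k l zero ⟩
          α * I.coef k zero + β * I.coef l zero    ≡⟨ cong₂ (λ s t → α * s + β * t) k₀≡0 l₀≡0 ⟩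
          α * 0# + β * 0#                          ≡⟨ solve 2 (λ α β → α :* :0 :+ β :* :0 := :0) refl α β ⟩
          0#                                       ∎)
      ; coef-combine  = λ 0<α 0<β (k , _) (l , _) i → I.coef-combine 0<α 0<β k l (suc i)
      ; bound-combine = λ 0<α 0<β (k , _) (l , _) z → I.bound-combine 0<α 0<β k l z
      }
      where module I = Inequalities I

    -- Only right-hand sides depend on z, so the signs of the coefficients, and with them `L₀`, are
    -- found before z is known. This allows z to be chosen afterwards as the largest value that the
    -- constants in `L₀` permit.
    eliminate : ∀ {n} (I : Inequalities n) (L : List (K I)) →
                Σ[ L₀ ∈ List (Constant I) ]
                  (∀ z → All (λ (k , _) → 0# ≤ bound I k z) L₀ → ∃ λ x → All (Holds I x z) L)
    eliminate {zero} I L = map (λ k → k , λ ()) L , λ z 0≤L → (λ ()) , All.map⁻ 0≤L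
    eliminate {suc n} I L =
      let Ps , Ns , Zs , covers = classify L
          L₀ , solution = eliminate (withoutHead I) (Zs ++ cartesianProductWith cancel Ps Ns)
      in map constant L₀ , λ z 0≤L₀ →
           let x , holds = solution z (All.map⁻ 0≤L₀)
               x₀ , Ls≤x₀ , x₀≤Us = between (map (lower z x) Ns) (map (upper z x) Ps)
                 (All.map⁺ (All.tabulate λ {l} l∈Ns → All.map⁺ (All.tabulate λ {k} k∈Ps →
                   lower≤upper z x k l (All.lookup (All.++⁻ʳ Zs holds) (∈-cartesianProductWith⁺ cancel k∈Ps l∈Ns)))))
           in extend x₀ x , covers
                (All.map (λ {k} → holds-upper z x x₀ k) (All.map⁻ x₀≤Us))
                (All.map (λ {l} → holds-lower z x x₀ l) (All.map⁻ Ls≤x₀))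
                (All.map (λ {k} → holds-zero z x x₀ k) (All.++⁻ˡ Zs holds))
      where
      module I = Inequalities I
      Pos Neg Zer : Set c
      Pos = Σ[ k ∈ I.K ] 0# < I.coef k zero
      Neg = Σ[ k ∈ I.K ] I.coef k zero < 0#
      Zer = K (withoutHead I)

      classify : ∀ L → ∃ λ (Ps : List Pos) → ∃ λ (Ns : List Neg) → ∃ λ (Zs : List Zer) →
                 ∀ {P : I.K → Set c} → All (P ∘ proj₁) Ps → All (P ∘ proj₁) Ns → All (P ∘ proj₁) Zs → All P L
      classify [] = [] , [] , [] , λ _ _ _ → []
      classify (k ∷ L) with classify L | compare (I.coef k zero) 0#
      ... | Ps , Ns , Zs , covers | tri< k₀<0 _ _ =
        Ps , (k , k₀<0) ∷ Ns , Zs , λ { p (n ∷ ns) z → n ∷ covers p ns z }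
      ... | Ps , Ns , Zs , covers | tri≈ _ k₀≡0 _ =
        Ps , Ns , (k , k₀≡0) ∷ Zs , λ { p n (z ∷ zs) → z ∷ covers p n zs }
      ... | Ps , Ns , Zs , covers | tri> _ _ 0<k₀ =
        (k , 0<k₀) ∷ Ps , Ns , Zs , λ { (p ∷ ps) n z → p ∷ covers ps n z }

      cancel : Pos → Neg → Zer
      cancel (k , 0<k₀) (l , l₀<0) = I.combine (neg-pos l₀<0) 0<k₀ k l ,
        trans (I.coef-combine (neg-pos l₀<0) 0<k₀ k l zero)
              (solve 2 (λ s t → :- t :* s :+ s :* t := :0) refl (I.coef k zero) (I.coef l zero))

      constant : Constant (withoutHead I) → Constant I
      constant ((k , k₀≡0) , k≡0) = k , λ { zero → k₀≡0 ; (suc i) → k≡0 i }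

      extend : Carrier → (Fin n → Carrier) → Fin (suc n) → Carrier
      extend x₀ x zero    = x₀
      extend x₀ x (suc i) = x i

      module _ (z : Carrier) (x : Fin n → Carrier) where
        rest : I.K → Carrier
        rest k = (I.coef k ∘ suc) · x

        upper : Pos → Carrier
        upper (k , 0<k₀) = proj₁ (inverse-pos 0<k₀) * (I.bound k z - rest k)

        lower : Neg → Carrier
        lower (l , l₀<0) = proj₁ (inverse-pos (neg-pos l₀<0)) * (rest l - I.bound l z)

        *-inverse-pos : ∀ {α} (0<α : 0# < α) y → α * (proj₁ (inverse-pos 0<α) * y) ≡ y
        *-inverse-pos {α} 0<α y = begin-equality
          α * (α⁻¹ * y)  ≡⟨ *-assoc α α⁻¹ y ⟨
          α * α⁻¹ * y    ≡⟨ cong (_* y) (proj₂ (proj₂ (inverse-pos 0<α))) ⟩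
          1# * y         ≡⟨ *-identityˡ y ⟩
          y              ∎
          where α⁻¹ = proj₁ (inverse-pos 0<α)

        holds-upper : ∀ x₀ k → x₀ ≤ upper k → Holds I (extend x₀ x) z (proj₁ k)
        holds-upper x₀ (k , 0<k₀) x₀≤u = begin
          I.coef k zero * x₀ + rest k                    ≤⟨ +-monoˡ-≤ _ (*-monoʳ-≤ (<⇒≤ 0<k₀) x₀≤u) ⟩
          I.coef k zero * upper (k , 0<k₀) + rest k      ≡⟨ cong (_+ rest k) (*-inverse-pos 0<k₀ _) ⟩
          I.bound k z - rest k + rest k                  ≡⟨ solve 2 (λ b r → b :- r :+ r := b) refl _ _ ⟩
          I.bound k z                                    ∎

        holds-lower : ∀ x₀ l → lower l ≤ x₀ → Holds I (extend x₀ x) z (proj₁ l)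
        holds-lower x₀ (l , l₀<0) l≤x₀ = begin
          I.coef l zero * x₀ + rest l
            ≡⟨ solve 4 (λ a x r b → a :* x :+ r := b :+ ((r :- b) :- :- a :* x)) refl (I.coef l zero) x₀ (rest l) (I.bound l z) ⟩
          I.bound l z + ((rest l - I.bound l z) - - I.coef l zero * x₀)
            ≡⟨ cong (λ t → I.bound l z + (t - - I.coef l zero * x₀)) (*-inverse-pos (neg-pos l₀<0) _) ⟨
          I.bound l z + (- I.coef l zero * lower (l , l₀<0) - - I.coef l zero * x₀)
            ≤⟨ +-mono-≤ ≤-refl (+-monoˡ-≤ _ (*-monoʳ-≤ (<⇒≤ (neg-pos l₀<0)) l≤x₀)) ⟩
          I.bound l z + (- I.coef l zero * x₀ - - I.coef l zero * x₀)
            ≡⟨ solve 2 (λ b y → b :+ (y :- y) := b) refl (I.bound l z) _ ⟩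
          I.bound l z ∎

        holds-zero : ∀ x₀ k → Holds (withoutHead I) x z k → Holds I (extend x₀ x) z (proj₁ k)
        holds-zero x₀ (k , k₀≡0) holds = begin
          I.coef k zero * x₀ + rest k  ≡⟨ cong (λ s → s * x₀ + rest k) k₀≡0 ⟩
          0# * x₀ + rest k             ≡⟨ solve 2 (λ x r → :0 :* x :+ r := r) refl x₀ _ ⟩
          rest k                       ≤⟨ holds ⟩
          I.bound k z                  ∎

        -- After multiplication by α * β > 0 this becomes the inequality obtained by cancelling the
        -- first unknown, which `x` already satisfies.
        lower≤upper : ∀ k l → Holds (withoutHead I) x z (cancel k l) → lower l ≤ upper k
        lower≤upper (k , 0<α) (l , l₀<0) holds =
          *-cancelˡ-≤ (*-pos 0<α 0<β) (0≤y-x⇒x≤y (subst (0# ≤_) identity (x≤y⇒0≤y-x combined)))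
          where
          0<β = neg-pos l₀<0
          α = I.coef k zero
          β = - I.coef l zero
          lo = lower (l , l₀<0)
          up = upper (k , 0<α)

          combined : β * rest k + α * rest l ≤ β * I.bound k z + α * I.bound l z
          combined = begin
            β * rest k + α * rest l
              ≡⟨ ·-linearˡ β α (I.coef k ∘ suc) (I.coef l ∘ suc) x ⟨
            (λ i → β * I.coef k (suc i) + α * I.coef l (suc i)) · x
              ≡⟨ ·-congˡ x (λ i → I.coef-combine 0<β 0<α k l (suc i)) ⟨
            rest (I.combine 0<β 0<α k l)
              ≤⟨ holds ⟩
            I.bound (I.combine 0<β 0<α k l) z
              ≡⟨ I.bound-combine 0<β 0<α k l z ⟩
            β * I.bound k z + α * I.bound l z ∎

          identity : (β * I.bound k z + α * I.bound l z) - (β * rest k + α * rest l)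
                     ≡ α * β * up - α * β * lo
          identity = begin-equality
            (β * I.bound k z + α * I.bound l z) - (β * rest k + α * rest l)
              ≡⟨ solve 6 (λ α β bk bl rk rl → (β :* bk :+ α :* bl) :- (β :* rk :+ α :* rl)
                            := β :* (bk :- rk) :- α :* (rl :- bl))
                   refl α β (I.bound k z) (I.bound l z) (rest k) (rest l) ⟩
            β * (I.bound k z - rest k) - α * (rest l - I.bound l z)
              ≡⟨ cong₂ (λ s t → β * s - α * t) (*-inverse-pos 0<α _) (*-inverse-pos 0<β _) ⟨
            β * (α * up) - α * (β * lo)
              ≡⟨ solve 4 (λ α β u l → β :* (α :* u) :- α :* (β :* l) := α :* β :* u :- α :* β :* l) refl α β up lo ⟩
            α * β * up - α * β * lo ∎

  -- Weak and strong linear programming duality.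

  module Duality {p q : ℕ}
    (A : Fin p → Fin q → Carrier)
    (a : Fin q → Carrier) (b : Fin p → Carrier) where
    open LinearAlgebra
    open FourierMotzkin

    Aᵀ : Fin q → Fin p → Carrier
    Aᵀ = transpose A

    -- Matchings on `τ` are extended by zero, so loads and values are sums over all edges whatever
    -- `τ` is, and enlarging `τ` only relaxes the conditions.
    record Primal (τ : Subset q) (f : Fin q → Carrier) : Set c where
      field
        nonneg  : ∀ e → 0# ≤ f e
        support : ∀ e → e ∉ τ → f e ≡ 0#
        load    : ∀ v → A v · f ≤ b v

    record Dual (τ : Subset q) (w : Fin p → Carrier) : Set c where
      field
        nonneg : ∀ v → 0# ≤ w v
        cover  : ∀ e → e ∈ τ → a e ≤ Aᵀ e · w

    -- By weak duality, equality of the two values certifies that both solutions are optimal; no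
    -- quantification over competitors is needed.
    record Optimal (τ : Subset q) (f : Fin q → Carrier) (w : Fin p → Carrier) : Set c where
      field
        primal : Primal τ f
        dual   : Dual τ w
        tight  : f · a ≡ w · b

    module _ {τ f w} (P : Primal τ f) (D : Dual τ w) where
      private
        module P = Primal P
        module D = Dual D

      -- Outside `τ` the cover may fail, but there `f` vanishes.
      value≤covered : ∀ e → f e * a e ≤ f e * (Aᵀ e · w)
      value≤covered e with e Subset.∈? τ
      ... | yes e∈τ = *-monoʳ-≤ (P.nonneg e) (D.cover e e∈τ)
      ... | no  e∉τ = subst (λ x → x * a e ≤ x * (Aᵀ e · w)) (sym (P.support e e∉τ))
                            (inj₂ (trans (zeroˡ _) (sym (zeroˡ _))))

      load≤capacity : ∀ v → w v * (A v · f) ≤ w v * b v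
      load≤capacity v = *-monoʳ-≤ (D.nonneg v) (P.load v)

      weak-duality : f · a ≤ w · b
      weak-duality = begin
        f · a                   ≤⟨ sum-mono value≤covered ⟩
        f · (λ e → Aᵀ e · w)    ≡⟨ ·-adjoint A w f ⟨
        w · (λ v → A v · f)     ≤⟨ sum-mono load≤capacity ⟩
        w · b                   ∎

      module _ (f·a≡w·b : f · a ≡ w · b) where
        private
          f·a≡covered : f · a ≡ f · (λ e → Aᵀ e · w)
          f·a≡covered = ≤-antisym (sum-mono value≤covered) (begin
            f · (λ e → Aᵀ e · w)   ≡⟨ ·-adjoint A w f ⟨
            w · (λ v → A v · f)    ≤⟨ sum-mono load≤capacity ⟩
            w · b                  ≡⟨ f·a≡w·b ⟨
            f · a                  ∎)

          load≡w·b : w · (λ v → A v · f) ≡ w · b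
          load≡w·b = trans (·-adjoint A w f) (trans (sym f·a≡covered) f·a≡w·b)

        -- Complementary slackness: equal values force equality throughout the chain of weak
        -- duality, hence in each term, and the nonzero factor `f e` can be cancelled.
        -- `tight-vertex` is the same on the dual side.
        tight-edge : ∀ e → f e ≢ 0# → a e ≡ Aᵀ e · w
        tight-edge e fe≢0 = x-y≡0⇒x≡y (*-zero-product fe≢0 (begin-equality
          f e * (a e - Aᵀ e · w)          ≡⟨ solve 3 (λ f a b → f :* (a :- b) := f :* a :- f :* b) refl (f e) (a e) _ ⟩
          f e * a e - f e * (Aᵀ e · w)    ≡⟨ cong (_- f e * (Aᵀ e · w)) (sum-mono-tight value≤covered f·a≡covered e) ⟩
          f e * (Aᵀ e · w) - f e * (Aᵀ e · w)  ≡⟨ -‿inverseʳ _ ⟩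
          0#                              ∎))

        tight-vertex : ∀ v → w v ≢ 0# → A v · f ≡ b v
        tight-vertex v wv≢0 = x-y≡0⇒x≡y (*-zero-product wv≢0 (begin-equality
          w v * (A v · f - b v)           ≡⟨ solve 3 (λ f a b → f :* (a :- b) := f :* a :- f :* b) refl (w v) _ (b v) ⟩
          w v * (A v · f) - w v * b v     ≡⟨ cong (_- w v * b v) (sum-mono-tight load≤capacity load≡w·b v) ⟩
          w v * b v - w v * b v           ≡⟨ -‿inverseʳ _ ⟩
          0#                              ∎))

    module StrongDuality (0≤b : ∀ v → 0# ≤ b v) (τ : Subset q) where

      -- The consequences  g · f ≤ w · b - s * z  of the primal system
      -- together with  z ≤ a · f.
      record Multiplier : Set c where
        field
          g     : Fin q → Carrier
          s     : Carrier
          w     : Fin p → Carrier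
          0≤s   : 0# ≤ s
          0≤w   : ∀ v → 0# ≤ w v
          valid : ∀ e → e ∈ τ → g e + s * a e ≤ Aᵀ e · w

      open Multiplier

      slack : Multiplier → Carrier → Carrier
      slack k z = w k · b - s k * z

      comb : ∀ {α β} → 0# < α → 0# < β → Multiplier → Multiplier → Multiplier
      comb {α} {β} 0<α 0<β k l = record
        { g     = λ e → α * g k e + β * g l e
        ; s     = α * s k + β * s l
        ; w     = λ v → α * w k v + β * w l v
        ; 0≤s   = +-nonneg (*-nonneg (<⇒≤ 0<α) (0≤s k)) (*-nonneg (<⇒≤ 0<β) (0≤s l))
        ; 0≤w   = λ v → +-nonneg (*-nonneg (<⇒≤ 0<α) (0≤w k v)) (*-nonneg (<⇒≤ 0<β) (0≤w l v))
        ; valid = λ e e∈τ → begin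
            α * g k e + β * g l e + (α * s k + β * s l) * a e
              ≡⟨ solve 7 (λ α β g h s t a → α :* g :+ β :* h :+ (α :* s :+ β :* t) :* a
                            := α :* (g :+ s :* a) :+ β :* (h :+ t :* a))
                   refl α β (g k e) (g l e) (s k) (s l) (a e) ⟩
            α * (g k e + s k * a e) + β * (g l e + s l * a e)
              ≤⟨ +-mono-≤ (*-monoʳ-≤ (<⇒≤ 0<α) (valid k e e∈τ)) (*-monoʳ-≤ (<⇒≤ 0<β) (valid l e e∈τ)) ⟩
            α * (Aᵀ e · w k) + β * (Aᵀ e · w l)
              ≡⟨ ·-linearʳ α β (Aᵀ e) (w k) (w l) ⟨
            Aᵀ e · (λ v → α * w k v + β * w l v) ∎
        }

      slack-comb : ∀ {α β} (0<α : 0# < α) (0<β : 0# < β) k l z →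
                   slack (comb 0<α 0<β k l) z ≡ α * slack k z + β * slack l z
      slack-comb {α} {β} 0<α 0<β k l z = begin-equality
        (λ v → α * w k v + β * w l v) · b - (α * s k + β * s l) * z
          ≡⟨ cong (_- (α * s k + β * s l) * z) (·-linearˡ α β (w k) (w l) b) ⟩
        α * (w k · b) + β * (w l · b) - (α * s k + β * s l) * z
          ≡⟨ solve 7 (λ α β x y s t z → α :* x :+ β :* y :- (α :* s :+ β :* t) :* z
                        := α :* (x :- s :* z) :+ β :* (y :- t :* z))
               refl α β (w k · b) (w l · b) (s k) (s l) z ⟩
        α * slack k z + β * slack l z ∎

      system : Inequalities q
      system = record
        { K = Multiplier ; coef = g ; bound = slack
        ; combine = comb ; coef-combine = λ _ _ _ _ _ → refl ; bound-combine = slack-comb }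

      loadRow : Fin p → Multiplier
      loadRow v = record
        { g = A v ; s = 0# ; w = δ v ; 0≤s = ≤-refl ; 0≤w = δ-nonneg v
        ; valid = λ e _ → inj₂ (begin-equality
            A v e + 0# * a e  ≡⟨ solve 2 (λ x y → x :+ :0 :* y := x) refl (A v e) (a e) ⟩
            A v e             ≡⟨ ·-δ (Aᵀ e) v ⟨
            Aᵀ e · δ v        ∎)
        }

      -- Needs no load constraint, since a matching is nonnegative on `τ` and zero elsewhere; both
      -- the sign and the support conditions arise in this way.
      supportRow : ∀ x → (∀ e → e ∈ τ → x e ≤ 0#) → Multiplier
      supportRow x x≤0 = record
        { g = x ; s = 0# ; w = λ _ → 0# ; 0≤s = ≤-refl ; 0≤w = λ _ → ≤-refl
        ; valid = λ e e∈τ → begin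
            x e + 0# * a e      ≡⟨ solve 2 (λ x y → x :+ :0 :* y := x) refl (x e) (a e) ⟩
            x e                 ≤⟨ x≤0 e e∈τ ⟩
            0#                  ≡⟨ ·-zeroʳ (Aᵀ e) ⟨
            Aᵀ e · (λ _ → 0#)   ∎
        }

      positiveRow : Fin q → Multiplier
      positiveRow e = supportRow (λ e′ → - δ e e′) λ e′ _ →
        subst₂ _≤_ (+-identityˡ _) (-‿inverseʳ _) (+-monoˡ-≤ (- δ e e′) (δ-nonneg e e′))

      outsideRow : Fin q → Multiplier
      outsideRow e with e Subset.∈? τ
      -- For edges of `τ` the row is the trivial 0 ≤ 0, so that the list can run over all edges.
      ... | yes _   = supportRow (λ _ → 0#) λ _ _ → ≤-refl
      ... | no  e∉τ = supportRow (δ e) λ e′ e′∈τ → inj₂ (δ-≢ {i = e} {e′} λ { refl → e∉τ e′∈τ })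

      objectiveRow : Multiplier
      objectiveRow = record
        { g = λ e → - a e ; s = 1# ; w = λ _ → 0# ; 0≤s = <⇒≤ 0<1 ; 0≤w = λ _ → ≤-refl
        ; valid = λ e _ → inj₂ (begin-equality
            - a e + 1# * a e   ≡⟨ solve 1 (λ a → :- a :+ :1 :* a := :0) refl (a e) ⟩
            0#                 ≡⟨ ·-zeroʳ (Aᵀ e) ⟨
            Aᵀ e · (λ _ → 0#)  ∎)
        }

      -- The bound z ≤ w₀ · b in the form of a multiplier. It is the starting point of `binding`,
      -- which needs some constraint with positive `s` even when elimination supplies none.
      coverRow : ∀ {w₀} → Dual τ w₀ → Multiplier
      coverRow {w₀} D = record
        { g = λ _ → 0# ; s = 1# ; w = w₀ ; 0≤s = <⇒≤ 0<1 ; 0≤w = Dual.nonneg D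
        ; valid = λ e e∈τ → subst (_≤ Aᵀ e · w₀)
            (solve 1 (λ a → a := :0 :+ :1 :* a) refl (a e)) (Dual.cover D e e∈τ)
        }

      rows : List Multiplier
      rows = objectiveRow ∷ map loadRow (allFin p) ++ map positiveRow (allFin q) ++ map outsideRow (allFin q)

      solution⇒primal : ∀ {f z} → All (Inequalities.Holds system f z) rows →
                        Primal τ f × z ≤ f · a
      solution⇒primal {f} {z} (obj ∷ holds) = record
          { nonneg  = 0≤f
          ; support = λ e e∉τ → ≤-antisym (outside≤0 e e∉τ) (0≤f e)
          ; load    = λ v → begin
              A v · f                 ≤⟨ All.lookup loads (∈-map⁺ loadRow (∈-allFin v)) ⟩
              δ v · b - 0# * z        ≡⟨ solve 2 (λ x z → x :- :0 :* z := x) refl _ z ⟩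
              δ v · b                 ≡⟨ trans (·-comm (δ v) b) (·-δ b v) ⟩
              b v                     ∎
          } , 0≤y-x⇒x≤y (subst (0# ≤_) (begin-equality
                slack objectiveRow z - (λ e → - a e) · f  ≡⟨ cong₂ _-_ (cong (_- 1# * z) (trans (·-comm _ b) (·-zeroʳ b))) (neg-· a) ⟩
                0# - 1# * z - - (a · f)                   ≡⟨ solve 2 (λ z y → :0 :- :1 :* z :- :- y := y :- z) refl z _ ⟩
                a · f - z                                 ≡⟨ cong (_- z) (·-comm a f) ⟩
                f · a - z                                 ∎) (x≤y⇒0≤y-x obj))
        where
        loads     = All.++⁻ˡ (map loadRow (allFin p)) holds
        positives = All.++⁻ˡ (map positiveRow (allFin q)) (All.++⁻ʳ (map loadRow (allFin p)) holds)
        outsides  = All.++⁻ʳ (map positiveRow (allFin q)) (All.++⁻ʳ (map loadRow (allFin p)) holds)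

        neg-· : ∀ x → (λ e → - x e) · f ≡ - (x · f)
        neg-· x = begin-equality
          (λ e → - x e) · f
            ≡⟨ ·-congˡ f (λ e → solve 1 (λ x → :- x := :- :1 :* x :+ :0 :* x) refl (x e)) ⟩
          (λ e → - 1# * x e + 0# * x e) · f
            ≡⟨ ·-linearˡ (- 1#) 0# x x f ⟩
          - 1# * (x · f) + 0# * (x · f)
            ≡⟨ solve 1 (λ x → :- :1 :* x :+ :0 :* x := :- x) refl _ ⟩
          - (x · f) ∎

        0-slack : ∀ z → (λ _ → 0#) · b - 0# * z ≡ 0#
        0-slack z = trans (cong (_- 0# * z) (trans (·-comm _ b) (·-zeroʳ b)))
                          (solve 1 (λ z → :0 :- :0 :* z := :0) refl z)

        0≤f : ∀ e → 0# ≤ f e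
        0≤f e = 0≤y-x⇒x≤y (subst (0# ≤_) (begin-equality
              slack (positiveRow e) z - (λ e′ → - δ e e′) · f
                ≡⟨ cong₂ _-_ (0-slack z) (neg-· (δ e)) ⟩
              0# - - (δ e · f)
                ≡⟨ solve 1 (λ x → :0 :- :- x := x :- :0) refl _ ⟩
              δ e · f - 0#
                ≡⟨ cong (_- 0#) (trans (·-comm (δ e) f) (·-δ f e)) ⟩
              f e - 0# ∎)
              (x≤y⇒0≤y-x (All.lookup positives (∈-map⁺ positiveRow (∈-allFin e)))))

        outside≤0 : ∀ e → e ∉ τ → f e ≤ 0#
        outside≤0 e e∉τ with e Subset.∈? τ | All.lookup outsides (∈-map⁺ outsideRow (∈-allFin e))
        ... | yes e∈τ | _    = contradiction e∈τ e∉τ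
        ... | no  _   | δf≤0 = begin
          f e                      ≡⟨ trans (·-comm (δ e) f) (·-δ f e) ⟨
          δ e · f                  ≤⟨ δf≤0 ⟩
          (λ _ → 0#) · b - 0# * z  ≡⟨ 0-slack z ⟩
          0#                       ∎

      -- A constant multiplier reads s * z ≤ w · b, so the wanted z is the minimum of the quotients
      -- (w · b) / s with s > 0, and `k` attains it. Whenever a constraint `l` fails, z is lowered
      -- to the quotient of `l`; lowering z never reduces another slack.
      binding : ∀ {w₀} → Dual τ w₀ → (L : List (Inequalities.Constant system)) →
                ∃ λ ((k , _) : Inequalities.Constant system) → 0# < s k ×
                ∃ λ z → slack k z ≡ 0# × All (λ (l , _) → 0# ≤ slack l z) L
      binding {w₀} D [] = (coverRow D , λ _ → refl) , 0<1 , w₀ · b ,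
        solve 1 (λ x → x :- :1 :* x := :0) refl _ , []
      binding D ((l , l≡0) ∷ L) with binding D L
      ... | k , 0<s , z , tight , fits with 0# ≤? slack l z
      ...   | yes 0≤l = k , 0<s , z , tight , 0≤l ∷ fits
      ...   | no  0≰l = (l , l≡0) , 0<sl , z′ , tight′ , inj₂ (sym tight′) ∷ All.map (λ {k} → tighter k) fits
        where
        l<0 : slack l z < 0#
        l<0 = ≰⇒> 0≰l

        -- A constraint without z holds automatically because b is nonnegative, so a violated one
        -- must involve z.
        sl≢0 : s l ≢ 0#
        sl≢0 sl≡0 = <⇒≱ l<0 (begin
          0#               ≤⟨ ·-nonneg (0≤w l) 0≤b ⟩
          w l · b          ≡⟨ solve 2 (λ x z → x := x :- :0 :* z) refl _ z ⟩
          w l · b - 0# * z ≡⟨ cong (λ s → w l · b - s * z) sl≡0 ⟨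
          slack l z        ∎)

        0<sl : 0# < s l
        0<sl = nonneg∧≢0⇒pos (0≤s l) sl≢0

        i = proj₁ (inverse-pos 0<sl)
        z′ = i * (w l · b)

        tight′ : slack l z′ ≡ 0#
        tight′ = begin-equality
          w l · b - s l * (i * (w l · b))  ≡⟨ solve 3 (λ x s i → x :- s :* (i :* x) := (:1 :- s :* i) :* x) refl (w l · b) (s l) i ⟩
          (1# - s l * i) * (w l · b)       ≡⟨ cong (λ t → (1# - t) * (w l · b)) (proj₂ (proj₂ (inverse-pos 0<sl))) ⟩
          (1# - 1#) * (w l · b)            ≡⟨ solve 1 (λ x → (:1 :- :1) :* x := :0) refl _ ⟩
          0#                               ∎

        z′≤z : z′ ≤ z
        z′≤z = *-cancelˡ-≤ 0<sl (0≤y-x⇒x≤y (<⇒≤ (subst (0# <_) (begin-equality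
          slack l z′ - slack l z          ≡⟨ solve 4 (λ x s z y → (x :- s :* y) :- (x :- s :* z) := s :* z :- s :* y)
                                               refl (w l · b) (s l) z z′ ⟩
          s l * z - s l * z′              ∎)
          (x<y⇒0<y-x (subst (slack l z <_) (sym tight′) l<0)))))

        tighter : ∀ (k : Inequalities.Constant system) → 0# ≤ slack (proj₁ k) z → 0# ≤ slack (proj₁ k) z′
        tighter (k , _) 0≤k = begin
          0#                 ≤⟨ 0≤k ⟩
          w k · b - s k * z  ≤⟨ 0≤y-x⇒x≤y (subst (0# ≤_)
                                  (solve 4 (λ x s z y → s :* (z :- y) := (x :- s :* y) :- (x :- s :* z))
                                     refl (w k · b) (s k) z z′)
                                  (*-nonneg (0≤s k) (x≤y⇒0≤y-x z′≤z))) ⟩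
          w k · b - s k * z′ ∎

      abstract
        -- At the z of `binding` the primal system is solvable, giving f with f · a ≥ z, while the
        -- binding multiplier divided by `s` is a cover of total weight exactly z.
        strong-duality : ∀ {w₀} → Dual τ w₀ → ∃ λ f → ∃ λ w → Optimal τ f w
        strong-duality D
          with L , solution ← eliminate system rows
          with (k , k≡0) , 0<s , z , tight , fits ← binding D L
          with f , holds ← solution z fits
          with P , z≤f·a ← solution⇒primal holds
          = f , w* , record
            { primal = P
            ; dual   = D*
            ; tight  = ≤-antisym (weak-duality P D*) (subst (_≤ f · a) z≡w*·b z≤f·a)
            }
          where
          i : Carrier
          i = proj₁ (inverse-pos 0<s)
          0<i : 0# < i
          0<i = proj₁ (proj₂ (inverse-pos 0<s))
          s*i≡1 : s k * i ≡ 1#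
          s*i≡1 = proj₂ (proj₂ (inverse-pos 0<s))

          w* : Fin p → Carrier
          w* v = i * w k v

          i*s*x≡x : ∀ x → i * (s k * x) ≡ x
          i*s*x≡x x = begin-equality
            i * (s k * x)  ≡⟨ solve 3 (λ i s x → i :* (s :* x) := s :* i :* x) refl i (s k) x ⟩
            s k * i * x    ≡⟨ cong (_* x) s*i≡1 ⟩
            1# * x         ≡⟨ *-identityˡ x ⟩
            x              ∎

          D* : Dual τ w*
          D* = record
            { nonneg = λ v → *-nonneg (<⇒≤ 0<i) (0≤w k v)
            ; cover  = λ e e∈τ → begin
                a e                          ≡⟨ i*s*x≡x (a e) ⟨
                i * (s k * a e)              ≡⟨ cong (i *_) (+-identityˡ _) ⟨
                i * (0# + s k * a e)         ≡⟨ cong (λ t → i * (t + s k * a e)) (k≡0 e) ⟨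
                i * (g k e + s k * a e)      ≤⟨ *-monoʳ-≤ (<⇒≤ 0<i) (valid k e e∈τ) ⟩
                i * (Aᵀ e · w k)             ≡⟨ ·-scaleʳ i (Aᵀ e) (w k) ⟨
                Aᵀ e · w*                    ∎
            }

          z≡w*·b : z ≡ w* · b
          z≡w*·b = begin-equality
            z                ≡⟨ i*s*x≡x z ⟨
            i * (s k * z)    ≡⟨ cong (i *_) (x-y≡0⇒x≡y tight) ⟨
            i * (w k · b)    ≡⟨ cong (i *_) (·-comm (w k) b) ⟩
            i * (b · w k)    ≡⟨ ·-scaleʳ i b (w k) ⟨
            b · w*           ≡⟨ ·-comm b w* ⟩
            w* · b           ∎

  -- Gaussian elimination and generic weight vectors.

  module Genericity where
    open LinearAlgebra

    Matrix : ℕ → ℕ → Set c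
    Matrix p q = Fin p → Fin q → Carrier

    -- The kernel of the submatrix with rows `S` and columns `σ`, its vectors extended by zero.
    record Kernel {p q} (B : Matrix p q) (S : Subset p) (σ : Subset q) (x : Fin q → Carrier) : Set c where
      field
        support    : ∀ j → j ∉ σ → x j ≡ 0#
        annihilate : ∀ i → i ∈ S → B i · x ≡ 0#

    open Kernel

    -- The cardinality bound is recorded with triviality because elimination yields both at once; it
    -- later compares the supports of matching and cover.
    NonTrivialKernel TrivialKernel : ∀ {p q} → Matrix p q → Subset p → Subset q → Set c
    NonTrivialKernel B S σ = ∃ λ x → Kernel B S σ x × ∃ λ j → x j ≢ 0#
    TrivialKernel B S σ = (∀ x → Kernel B S σ x → ∀ j → x j ≡ 0#) × ∣ σ ∣ ≤ℕ ∣ S ∣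

    -- Elimination along the columns in σ. Each pivot uses up one row of S, so if every column finds
    -- a pivot there are at least as many rows as columns.
    gauss : ∀ {p q} (B : Matrix p q) S σ → NonTrivialKernel B S σ ⊎ TrivialKernel B S σ
    gauss {p} {zero} B S [] = inj₂ ((λ _ _ ()) , ℕ.z≤n)
    gauss {p} {suc q} B S (outside ∷ σ) with gauss (λ i → B i ∘ suc) S σ
    ... | inj₁ (x , K , j , xj≢0) = inj₁ (x⁺ , record
        { support    = λ { zero _ → refl ; (suc j) j∉ → support K j (j∉ ∘ there) }
        ; annihilate = λ i i∈S → begin-equality
            B i zero * 0# + (B i ∘ suc) · x  ≡⟨ cong₂ _+_ (zeroʳ _) (annihilate K i i∈S) ⟩
            0# + 0#                          ≡⟨ +-identityˡ 0# ⟩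
            0#                               ∎
        } , suc j , xj≢0)
      where
      x⁺ : Fin (suc q) → Carrier
      x⁺ zero    = 0#
      x⁺ (suc j) = x j
    ... | inj₂ (trivial , σ≤S) = inj₂ ((λ x K → λ
        { zero    → support K zero λ ()
        ; (suc j) → trivial (x ∘ suc) (record
            { support    = λ j j∉σ → support K (suc j) λ { (there j∈σ) → j∉σ j∈σ }
            ; annihilate = λ i i∈S → begin-equality
                (B i ∘ suc) · (x ∘ suc)
                  ≡⟨ solve 2 (λ b t → t := b :* :0 :+ t) refl (B i zero) _ ⟩
                B i zero * 0# + (B i ∘ suc) · (x ∘ suc)
                  ≡⟨ cong (λ x₀ → B i zero * x₀ + (B i ∘ suc) · (x ∘ suc)) (support K zero λ ()) ⟨
                B i · x
                  ≡⟨ annihilate K i i∈S ⟩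
                0# ∎
            }) j
        }) , σ≤S)
    gauss {p} {suc q} B S (inside ∷ σ)
      with Fin.any? (λ i → (i Subset.∈? S) ×-dec ¬? (B i zero ≟ 0#))
    -- The first column vanishes on all rows of S, so its unit vector is in the kernel.
    ... | no noPivot = inj₁ (δ zero , record
        { support    = λ { zero 0∉ → contradiction here 0∉ ; (suc j) _ → refl }
        ; annihilate = λ i i∈S → trans (·-δ (B i) zero)
            (decidable-stable (B i zero ≟ 0#) λ ≢0 → noPivot (i , i∈S , ≢0))
        } , zero , 0≢1 ∘ sym)
    ... | yes (i₀ , i₀∈S , α≢0) = solveReduced (gauss B′ (S ∖ i₀) σ)
      where
      α = B i₀ zero
      α⁻¹ = proj₁ (inverse α α≢0)

      B′ : Matrix p q
      -- Row reduction without division; the pivot row becomes zero and leaves S.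
      B′ i j = α * B i (suc j) + - B i zero * B i₀ (suc j)

      solveReduced : NonTrivialKernel B′ (S ∖ i₀) σ ⊎ TrivialKernel B′ (S ∖ i₀) σ →
                     NonTrivialKernel B S (inside ∷ σ) ⊎ TrivialKernel B S (inside ∷ σ)
      solveReduced (inj₁ (x , K , j , xj≢0)) = inj₁ (x⁺ , record
          { support    = λ { zero 0∉ → contradiction here 0∉ ; (suc j) j∉ → support K j (j∉ ∘ there) }
          ; annihilate = λ i i∈S → *-zero-product α≢0 (begin-equality
              α * (B i zero * - (α⁻¹ * t i₀) + t i)
                ≡⟨ solve 5 (λ α β i t u → α :* (β :* :- (i :* t) :+ u) := α :* u :+ :- β :* (α :* i :* t))
                     refl α (B i zero) α⁻¹ (t i₀) (t i) ⟩
              α * t i + - B i zero * (α * α⁻¹ * t i₀)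
                ≡⟨ cong (λ y → α * t i + - B i zero * (y * t i₀)) (proj₂ (inverse α α≢0)) ⟩
              α * t i + - B i zero * (1# * t i₀)
                ≡⟨ cong (λ y → α * t i + - B i zero * y) (*-identityˡ _) ⟩
              α * t i + - B i zero * t i₀
                ≡⟨ reduced i i∈S ⟩
              0# ∎)
          } , suc j , xj≢0)
        where
        t : Fin p → Carrier
        t i = (B i ∘ suc) · x

        x⁺ : Fin (suc q) → Carrier
        -- Back substitution: the pivot row is solved for the first unknown.
        x⁺ zero    = - (α⁻¹ * t i₀)
        x⁺ (suc j) = x j

        reduced : ∀ i → i ∈ S → α * t i + - B i zero * t i₀ ≡ 0#
        reduced i i∈S with i Fin.≟ i₀
        ... | yes refl = solve 2 (λ a t → a :* t :+ :- a :* t := :0) refl (B i zero) (t i)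
        ... | no  i≢i₀ = trans (sym (·-linearˡ α (- B i zero) (B i ∘ suc) (B i₀ ∘ suc) x))
                               (annihilate K i (Subset.x∈p∧x≢y⇒x∈p-y i∈S i≢i₀))
      solveReduced (inj₂ (trivial , σ≤S∖i₀)) =
        inj₂ (vanish , ℕ.≤-trans (ℕ.s≤s σ≤S∖i₀) (Subset.x∈p⇒∣p-x∣<∣p∣ i₀∈S))
        where
        vanish : ∀ x → Kernel B S (inside ∷ σ) x → ∀ j → x j ≡ 0#
        vanish x K = λ { zero → head≡0 ; (suc j) → tail≡0 j }
          where
          t : Fin p → Carrier
          t i = (B i ∘ suc) · (x ∘ suc)

          tail≡0 : ∀ j → x (suc j) ≡ 0#
          tail≡0 = trivial (x ∘ suc) record
            { support    = λ j j∉σ → support K (suc j) λ { (there j∈σ) → j∉σ j∈σ }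
            ; annihilate = λ i i∈S∖i₀ → begin-equality
                B′ i · (x ∘ suc)
                  ≡⟨ ·-linearˡ α (- B i zero) (B i ∘ suc) (B i₀ ∘ suc) (x ∘ suc) ⟩
                α * t i + - B i zero * t i₀
                  ≡⟨ solve 5 (λ α β x t u → α :* u :+ :- β :* t := α :* (β :* x :+ u) :- β :* (α :* x :+ t))
                       refl α (B i zero) (x zero) (t i₀) (t i) ⟩
                α * (B i · x) - B i zero * (B i₀ · x)
                  ≡⟨ cong₂ (λ y z → α * y - B i zero * z)
                           (annihilate K i (Subset.p─q⊆p S _ i∈S∖i₀)) (annihilate K i₀ i₀∈S) ⟩
                α * 0# - B i zero * 0#
                  ≡⟨ solve 2 (λ α β → α :* :0 :- β :* :0 := :0) refl α (B i zero) ⟩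
                0# ∎
            }

          head≡0 : x zero ≡ 0#
          head≡0 = *-zero-product α≢0 (begin-equality
            α * x zero             ≡⟨ +-identityʳ _ ⟨
            α * x zero + 0#        ≡⟨ cong (α * x zero +_) (sum-zero λ j → trans (cong (B i₀ (suc j) *_) (tail≡0 j)) (zeroʳ _)) ⟨
            B i₀ · x               ≡⟨ annihilate K i₀ i₀∈S ⟩
            0#                     ∎)

    bump : ∀ {n} → (Fin n → Carrier) → Fin n → Carrier → Fin n → Carrier
    bump x j ε i = x i + ε * δ j i

    ·-bump : ∀ {n} (h x : Fin n → Carrier) j ε → h · bump x j ε ≡ h · x + ε * h j
    ·-bump h x j ε = begin-equality
      h · bump x j ε                        ≡⟨ sum-cong-≗ (λ i → cong (λ y → h i * (y + ε * δ j i)) (sym (*-identityˡ (x i)))) ⟩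
      h · (λ i → 1# * x i + ε * δ j i)      ≡⟨ ·-linearʳ 1# ε h x (δ j) ⟩
      1# * (h · x) + ε * (h · δ j)          ≡⟨ cong₂ (λ y z → y + ε * z) (*-identityˡ _) (·-δ h j) ⟩
      h · x + ε * h j                       ∎

    -- An explicit threshold lets one ε serve finitely many such properties.
    Eventually : (Carrier → Set c) → Set c
    Eventually P = ∃ λ ε₀ → 0# < ε₀ × (∀ ε → 0# < ε → ε ≤ ε₀ → P ε)

    eventually-map : ∀ {P Q : Carrier → Set c} → (∀ {ε} → P ε → Q ε) → Eventually P → Eventually Q
    eventually-map f (ε₀ , 0<ε₀ , p) = ε₀ , 0<ε₀ , λ ε 0<ε ε≤ε₀ → f (p ε 0<ε ε≤ε₀)

    eventually-× : ∀ {P Q : Carrier → Set c} → Eventually P → Eventually Q → Eventually (λ ε → P ε × Q ε)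
    eventually-× (ε₁ , 0<ε₁ , p) (ε₂ , 0<ε₂ , q) with ε₁ ≤? ε₂
    ... | yes ε₁≤ε₂ = ε₁ , 0<ε₁ , λ ε 0<ε ε≤ → p ε 0<ε ε≤ , q ε 0<ε (≤-trans ε≤ ε₁≤ε₂)
    ... | no  ε₁≰ε₂ = ε₂ , 0<ε₂ , λ ε 0<ε ε≤ → p ε 0<ε (≤-trans ε≤ (<⇒≤ (≰⇒> ε₁≰ε₂))) , q ε 0<ε ε≤

    eventually-All : ∀ {I : Set} {P : I → Carrier → Set c} (L : List I) →
                     All (λ i → Eventually (P i)) L → Eventually (λ ε → ∀ {i} → i ∈ᴸ L → P i ε)
    eventually-All [] [] = 1# , 0<1 , λ _ _ _ ()
    eventually-All (i ∷ L) (e ∷ es) =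
      eventually-map (λ (p , ps) → λ { (Any.here refl) → p ; (Any.there i∈L) → ps i∈L })
                     (eventually-× e (eventually-All L es))

    eventually-< : ∀ {x y} h → x < y → Eventually (λ ε → x + ε * h < y)
    eventually-< {x} {y} h x<y with h ≤? 0#
    ... | yes h≤0 = 1# , 0<1 , λ ε 0<ε _ → begin-strict
      x + ε * h   ≤⟨ +-mono-≤ ≤-refl (*-monoʳ-≤ (<⇒≤ 0<ε) h≤0) ⟩
      x + ε * 0#  ≡⟨ solve 2 (λ x ε → x :+ ε :* :0 := x) refl x ε ⟩
      x           <⟨ x<y ⟩
      y           ∎
    -- The threshold is (y - x) / (1 + h); the added 1 turns ε * h ≤ y - x into a strict inequality.
    ... | no  h≰0 = (y - x) * i , *-pos (x<y⇒0<y-x x<y) (proj₁ (proj₂ inv)) , λ ε 0<ε ε≤ → begin-strict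
      x + ε * h                       ≡⟨ +-comm x _ ⟩
      ε * h + x                       <⟨ +-mono-< x (*-monoʳ-< 0<ε h<1+h) ⟩
      ε * (1# + h) + x                ≤⟨ +-monoˡ-≤ x (*-monoˡ-≤ (<⇒≤ 0<1+h) ε≤) ⟩
      (y - x) * i * (1# + h) + x      ≡⟨ solve 4 (λ x y i h → (y :- x) :* i :* h :+ x := (y :- x) :* (h :* i) :+ x) refl x y i (1# + h) ⟩
      (y - x) * ((1# + h) * i) + x    ≡⟨ cong (λ u → (y - x) * u + x) (proj₂ (proj₂ inv)) ⟩
      (y - x) * 1# + x                ≡⟨ solve 2 (λ x y → (y :- x) :* :1 :+ x := y) refl x y ⟩
      y                               ∎
      where
      h<1+h : h < 1# + h
      h<1+h = subst (_< 1# + h) (+-identityˡ h) (+-mono-< h 0<1)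
      0<1+h : 0# < 1# + h
      0<1+h = <-trans (≰⇒> h≰0) h<1+h
      inv = inverse-pos 0<1+h
      i = proj₁ inv

    -- Stability under small increases of a single coordinate, the only moves made, so that weights
    -- never go down.
    Open : ∀ {n} → ((Fin n → Carrier) → Set c) → Set c
    Open U = ∀ x j → U x → Eventually (λ ε → U (bump x j ε))

    open-·< : ∀ {n} (h : Fin n → Carrier) y → Open (λ x → h · x < y)
    open-·< h y x j h·x<y = eventually-map (λ {ε} → subst (_< y) (sym (·-bump h x j ε)))
                                           (eventually-< (h j) h·x<y)

    open-≢0 : ∀ {n} (h : Fin n → Carrier) → Open (λ x → h · x ≢ 0#)
    open-≢0 h x j h·x≢0 with compare (h · x) 0#
    ... | tri< h·x<0 _ _ = eventually-map (λ lt eq → <-irrefl eq lt) (open-·< h 0# x j h·x<0)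
    ... | tri≈ _ h·x≡0 _ = contradiction h·x≡0 h·x≢0
    ... | tri> _ _ 0<h·x = eventually-map
      (λ {ε} lt eq → <-irrefl (trans (solve 3 (λ y ε h → :- y :+ ε :* :- h := :- (y :+ ε :* h)) refl _ _ _)
                                     (trans (cong -_ (trans (sym (·-bump h x j ε)) eq)) -0≡0)) lt)
      (eventually-< (- h j) (subst (- (h · x) <_) -0≡0 neg<))
      where
      -0≡0 : - 0# ≡ 0#
      -0≡0 = solve 0 (:- :0 := :0) refl
      neg< : - (h · x) < - 0#
      neg< = 0<y-x⇒x<y (subst (0# <_) (solve 1 (λ y → y := :- :0 :- :- y) refl _) 0<h·x)

    open-when : ∀ {n} {P : Set c} {U : (Fin n → Carrier) → Set c} → Dec P → Open U → Open (λ x → P → U x)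
    open-when (yes p) open-U x j Ux = eventually-map (λ u _ → u) (open-U x j (Ux p))
    open-when (no ¬p) open-U x j Ux = 1# , 0<1 , λ _ _ _ p → contradiction p ¬p

    open-All : ∀ {I : Set} {k} {U : I → (Fin k → Carrier) → Set c} (L : List I) → (∀ i → Open (U i)) →
               Open (λ x → ∀ {i} → i ∈ᴸ L → U i x)
    open-All {U = U} L open-U x j Ux =
      eventually-All {P = λ i ε → U i (bump x j ε)} L (All.tabulate λ {i} i∈L → open-U i x j (Ux i∈L))

    module _ {p q} (B : Matrix p q) where

      -- One kernel vector not orthogonal to x already rules out that x agrees on σ with a
      -- combination of the rows in S. Asking for a single witness makes the condition stable under
      -- small changes of x.
      GenericFor : Subset p × Subset q → (Fin q → Carrier) → Set c
      GenericFor (S , σ) x = (∃ λ y → Kernel B S σ y × y · x ≢ 0#) ⊎ TrivialKernel B S σ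

      Generic : (Fin q → Carrier) → Set c
      Generic x = ∀ S σ → GenericFor (S , σ) x

      open-genericFor : ∀ Sσ → Open (GenericFor Sσ)
      open-genericFor _ x j (inj₁ (y , K , y·x≢0)) = eventually-map (λ ne → inj₁ (y , K , ne)) (open-≢0 y x j y·x≢0)
      open-genericFor _ x j (inj₂ trivial)         = 1# , 0<1 , λ _ _ _ → inj₂ trivial

      -- If y · x = 0 and y j ≠ 0, increasing coordinate j by ε changes the product to ε * y j. Any
      -- ε > 0 works, which leaves room to take it small.
      dense-genericFor : ∀ Sσ x → GenericFor Sσ x ⊎ ∃ λ j → ∀ ε → 0# < ε → GenericFor Sσ (bump x j ε)
      dense-genericFor (S , σ) x with gauss B S σ
      ... | inj₂ trivial = inj₁ (inj₂ trivial)
      ... | inj₁ (y , K , j , yj≢0) with y · x ≟ 0#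
      ...   | no  y·x≢0 = inj₁ (inj₁ (y , K , y·x≢0))
      ...   | yes y·x≡0 = inj₂ (j , λ ε 0<ε → inj₁ (y , K , λ eq → yj≢0 (*-zero-product (<⇒≢ 0<ε) (begin-equality
        ε * y j               ≡⟨ +-identityˡ _ ⟨
        0# + ε * y j          ≡⟨ cong (_+ ε * y j) y·x≡0 ⟨
        y · x + ε * y j       ≡⟨ ·-bump y x j ε ⟨
        y · bump x j ε        ≡⟨ eq ⟩
        0#                    ∎))))

      bump-≥ : ∀ {n} (x : Fin n → Carrier) j {ε} → 0# < ε → ∀ i → x i ≤ bump x j ε i
      bump-≥ x j {ε} 0<ε i = subst (_≤ bump x j ε i) (+-identityʳ (x i))
        (+-mono-≤ ≤-refl (*-nonneg (<⇒≤ 0<ε) (δ-nonneg j i)))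

      abstract
        -- The finitely many pairs (S , σ) are repaired one after another, each time by a bump too
        -- small to damage `U` or a pair already repaired.
        perturb : ∀ {U} → Open U → ∀ x → U x → ∃ λ x′ → (∀ i → x i ≤ x′ i) × U x′ × Generic x′
        perturb {U} open-U x Ux =
          let x′ , x≤x′ , Ux′ , generic = go (cartesianProduct (allSubsets p) (allSubsets q))
          in x′ , x≤x′ , Ux′ , λ S σ → generic (∈-cartesianProduct⁺ (∈-allSubsets S) (∈-allSubsets σ))
          where
          go : ∀ L → ∃ λ x′ → (∀ i → x i ≤ x′ i) × U x′ × (∀ {Sσ} → Sσ ∈ᴸ L → GenericFor Sσ x′)
          go [] = x , (λ _ → ≤-refl) , Ux , λ ()
          go (Sσ ∷ L) with go L
          ... | x′ , x≤x′ , Ux′ , generic with dense-genericFor Sσ x′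
          ...   | inj₁ g = x′ , x≤x′ , Ux′ , λ { (Any.here refl) → g ; (Any.there ∈L) → generic ∈L }
          ...   | inj₂ (j , g)
                  with ε , 0<ε , good ← eventually-× (open-U x′ j Ux′)
                         (eventually-All {P = λ Tρ ε → GenericFor Tρ (bump x′ j ε)} L
                           (All.tabulate λ {Tρ} ∈L → open-genericFor Tρ x′ j (generic ∈L)))
                  = bump x′ j ε , (λ i → ≤-trans (x≤x′ i) (bump-≥ x′ j 0<ε i))
                  , proj₁ (good ε 0<ε ≤-refl)
                  , λ { (Any.here refl) → g ε 0<ε ; (Any.there ∈L) → proj₂ (good ε 0<ε ≤-refl) ∈L }

  -- Uniqueness of optima and the intervals they define.

  module LinearPrograms {p q : ℕ} (A : Fin p → Fin q → Carrier) where
    open LinearAlgebra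
    open Genericity

    supp : ∀ {n} → (Fin n → Carrier) → Subset n
    supp x = comprehension λ i → ¬? (x i ≟ 0#)

    ∈-supp⁻ : ∀ {n} (x : Fin n → Carrier) {i} → i ∈ supp x → x i ≢ 0#
    ∈-supp⁻ x = ∈-comprehension⁻ λ i → ¬? (x i ≟ 0#)

    ∉-supp : ∀ {n} (x : Fin n → Carrier) {i} → i ∉ supp x → x i ≡ 0#
    ∉-supp x {i} i∉ = decidable-stable (x i ≟ 0#) λ ≢0 → i∉ (∈-comprehension⁺ (λ i → ¬? (x i ≟ 0#)) ≢0)

    -- For a kernel vector z, z · x = z · Bᵀy = y · Bz = 0, because z lives on σ and y on S. This
    -- excludes the first alternative of genericity.
    trivial-kernel : ∀ {p q} (B : Matrix p q) {x : Fin q → Carrier} → Generic B x →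
                     ∀ (y : Fin p → Carrier) {S σ} → (∀ i → i ∉ S → y i ≡ 0#) →
                     (∀ j → j ∈ σ → x j ≡ transpose B j · y) → TrivialKernel B S σ
    trivial-kernel B {x} generic y {S} {σ} y-supp x≡By with generic S σ
    ... | inj₂ trivial = trivial
    ... | inj₁ (z , K , z·x≢0) = contradiction (begin-equality
        z · x                           ≡⟨ sum-cong-≗ on-σ ⟩
        z · (λ j → transpose B j · y)   ≡⟨ ·-adjoint B y z ⟨
        y · (λ i → B i · z)             ≡⟨ sum-zero on-S ⟩
        0#                              ∎) z·x≢0
      where
      on-σ : ∀ j → z j * x j ≡ z j * (transpose B j · y)
      on-σ j with j Subset.∈? σ
      ... | yes j∈σ = cong (z j *_) (x≡By j j∈σ)
      ... | no  j∉σ = begin-equality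
        z j * x j                      ≡⟨ cong (_* x j) (Kernel.support K j j∉σ) ⟩
        0# * x j                       ≡⟨ solve 2 (λ x y → :0 :* x := :0 :* y) refl (x j) _ ⟩
        0# * (transpose B j · y)       ≡⟨ cong (_* (transpose B j · y)) (Kernel.support K j j∉σ) ⟨
        z j * (transpose B j · y)      ∎
      on-S : ∀ i → y i * (B i · z) ≡ 0#
      on-S i with i Subset.∈? S
      ... | yes i∈S = trans (cong (y i *_) (Kernel.annihilate K i i∈S)) (zeroʳ (y i))
      ... | no  i∉S = trans (cong (_* (B i · z)) (y-supp i i∉S)) (zeroˡ (B i · z))

    -- The difference z - z′ lies in the kernel for the rows supp y and the columns supp z ∪ supp
    -- z′. Being symmetric in the two sides of the program, it serves matchings (`A`, weights a) and
    -- covers (`Aᵀ`, weights b) alike.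
    determined : ∀ {p q} (B : Matrix p q) {x : Fin q → Carrier} → Generic B x →
                 ∀ (y : Fin p → Carrier) {z z′ : Fin q → Carrier} →
                 (∀ j → z j ≢ 0# ⊎ z′ j ≢ 0# → x j ≡ transpose B j · y) →
                 (∀ i → y i ≢ 0# → B i · z ≡ B i · z′) → ∀ j → z j ≡ z′ j
    determined {q = q} B generic y {z} {z′} x≡By Bz≡Bz′ j = x-y≡0⇒x≡y (trans
      (solve 2 (λ x y → x :- y := :1 :* x :+ :- :1 :* y) refl (z j) (z′ j))
      (proj₁ (trivial-kernel B generic y {supp y} {σ} (λ i → ∉-supp y)
                (λ j → x≡By j ∘ ∈-comprehension⁻ either?)) d K j))
      where
      either? : Decidable (λ j → z j ≢ 0# ⊎ z′ j ≢ 0#)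
      either? j = ¬? (z j ≟ 0#) ⊎-dec ¬? (z′ j ≟ 0#)
      σ = comprehension either?
      d : Fin q → Carrier
      d j = 1# * z j + - 1# * z′ j
      K : Kernel B (supp y) σ d
      K = record
        { support    = λ j j∉σ → begin-equality
            1# * z j + - 1# * z′ j
              ≡⟨ cong₂ (λ x y → 1# * x + - 1# * y)
                   (decidable-stable (z j ≟ 0#) (j∉σ ∘ ∈-comprehension⁺ either? ∘ inj₁))
                   (decidable-stable (z′ j ≟ 0#) (j∉σ ∘ ∈-comprehension⁺ either? ∘ inj₂)) ⟩
            1# * 0# + - 1# * 0#
              ≡⟨ solve 0 (:1 :* :0 :+ :- :1 :* :0 := :0) refl ⟩
            0# ∎
        ; annihilate = λ i i∈S → begin-equality
            B i · d
              ≡⟨ ·-linearʳ 1# (- 1#) (B i) z z′ ⟩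
            1# * (B i · z) + - 1# * (B i · z′)
              ≡⟨ cong (λ t → 1# * t + - 1# * (B i · z′)) (Bz≡Bz′ i (∈-supp⁻ y i∈S)) ⟩
            1# * (B i · z′) + - 1# * (B i · z′)
              ≡⟨ solve 1 (λ x → :1 :* x :+ :- :1 :* x := :0) refl (B i · z′) ⟩
            0# ∎
        }

    module Solved (a : Fin q → Carrier) (b : Fin p → Carrier) (0≤b : ∀ v → 0# ≤ b v)
                  (w₀ : Fin p → Carrier) (0≤w₀ : ∀ v → 0# ≤ w₀ v)
                  (w₀-cover : ∀ e → a e ≤ transpose A e · w₀) where
      open Duality A a b public
      open Primal
      open Dual
      open Optimal

      optimal : ∀ τ → ∃ λ f → ∃ λ w → Optimal τ f w
      optimal τ = StrongDuality.strong-duality 0≤b τ record { nonneg = 0≤w₀ ; cover = λ e _ → w₀-cover e }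

      f* : Subset q → Fin q → Carrier
      f* τ = proj₁ (optimal τ)

      w* : Subset q → Fin p → Carrier
      w* τ = proj₁ (proj₂ (optimal τ))

      opt : ∀ τ → Optimal τ (f* τ) (w* τ)
      opt τ = proj₂ (proj₂ (optimal τ))

      ν : Subset q → Carrier
      ν τ = f* τ · a

      Primal-mono : ∀ {σ τ f} → σ ⊆ τ → Primal σ f → Primal τ f
      Primal-mono σ⊆τ P = record
        { nonneg = nonneg P ; support = λ e e∉τ → support P e (e∉τ ∘ σ⊆τ) ; load = load P }

      Dual-antitone : ∀ {σ τ w} → σ ⊆ τ → Dual τ w → Dual σ w
      Dual-antitone σ⊆τ D = record { nonneg = nonneg D ; cover = λ e e∈σ → cover D e (σ⊆τ e∈σ) }

      primal≤ν : ∀ {τ f} → Primal τ f → f · a ≤ ν τ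
      primal≤ν {τ} {f} P = begin
        f · a       ≤⟨ weak-duality P (dual (opt τ)) ⟩
        w* τ · b    ≡⟨ tight (opt τ) ⟨
        ν τ         ∎

      ν-mono : ∀ {σ τ} → σ ⊆ τ → ν σ ≤ ν τ
      ν-mono {σ} σ⊆τ = primal≤ν (Primal-mono σ⊆τ (primal (opt σ)))

      -- The circle f · a ≤ w′ · b = f′ · a ≤ w · b = f · a consists of equalities.
      optimal-mixed : ∀ {τ f w f′ w′} → Optimal τ f w → Optimal τ f′ w′ → Optimal τ f w′
      optimal-mixed {τ} {f} {w} {f′} {w′} O O′ = record
        { primal = primal O
        ; dual   = dual O′
        ; tight  = ≤-antisym (weak-duality (primal O) (dual O′)) (begin
            w′ · b  ≡⟨ tight O′ ⟨
            f′ · a  ≤⟨ weak-duality (primal O′) (dual O) ⟩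
            w · b   ≡⟨ tight O ⟨
            f · a   ∎)
        }

      ν-optimal : ∀ {τ f w} → Optimal τ f w → f · a ≡ ν τ
      ν-optimal {τ} O = trans (tight (optimal-mixed O (opt τ))) (sym (tight (opt τ)))

      module Unique (generic-a : Generic A a) (generic-b : Generic Aᵀ b) where

        -- Edges used by either matching are tight for w, and both matchings saturate the vertices
        -- of supp w, so `determined` applies.
        f-unique : ∀ {τ f f′ w} → Optimal τ f w → Optimal τ f′ w → ∀ e → f e ≡ f′ e
        f-unique {w = w} O O′ = determined A generic-a w
          (λ { e (inj₁ fe≢0)  → tight-edge (primal O) (dual O) (tight O) e fe≢0
             ; e (inj₂ f′e≢0) → tight-edge (primal O′) (dual O′) (tight O′) e f′e≢0 })
          (λ v wv≢0 → trans (tight-vertex (primal O) (dual O) (tight O) v wv≢0)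
                            (sym (tight-vertex (primal O′) (dual O′) (tight O′) v wv≢0)))

        w-unique : ∀ {τ f w w′} → Optimal τ f w → Optimal τ f w′ → ∀ v → w v ≡ w′ v
        w-unique {f = f} O O′ = determined Aᵀ generic-b f
          (λ { v (inj₁ wv≢0)  → sym (tight-vertex (primal O) (dual O) (tight O) v wv≢0)
             ; v (inj₂ w′v≢0) → sym (tight-vertex (primal O′) (dual O′) (tight O′) v w′v≢0) })
          (λ e fe≢0 → trans (sym (tight-edge (primal O) (dual O) (tight O) e fe≢0))
                            (tight-edge (primal O′) (dual O′) (tight O′) e fe≢0))

        -- On supp f the weights a are a combination of the rows in supp w, so that submatrix has
        -- trivial kernel and cannot have more columns than rows.
        ∣supp-f∣≤∣supp-w∣ : ∀ {τ f w} → Optimal τ f w → ∣ supp f ∣ ≤ℕ ∣ supp w ∣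
        ∣supp-f∣≤∣supp-w∣ {τ} {f} {w} O = proj₂ (trivial-kernel A generic-a w {supp w} {supp f}
          (λ v → ∉-supp w) (λ e e∈ → tight-edge (primal O) (dual O) (tight O) e (∈-supp⁻ f e∈)))

        covered? : ∀ w → Decidable (λ e → a e ≤ Aᵀ e · w)
        covered? w e = a e ≤? Aᵀ e · w

        B C : Subset q → Subset q
        B τ = supp (f* τ)
        C τ = comprehension (covered? (w* τ))

        B⊆ : ∀ τ → B τ ⊆ τ
        B⊆ τ {e} e∈B = decidable-stable (e Subset.∈? τ)
          λ e∉τ → ∈-supp⁻ (f* τ) e∈B (support (primal (opt τ)) e e∉τ)

        ⊆C : ∀ τ → τ ⊆ C τ
        ⊆C τ {e} e∈τ = ∈-comprehension⁺ (covered? (w* τ)) (cover (dual (opt τ)) e e∈τ)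

        -- The pair chosen for τ stays optimal on its own support, and likewise on the set its cover
        -- covers.
        ν-B : ∀ τ → ν (B τ) ≡ ν τ
        ν-B τ = sym (ν-optimal record
          { primal = record { nonneg = nonneg (primal (opt τ)) ; support = λ e → ∉-supp (f* τ) ; load = load (primal (opt τ)) }
          ; dual   = Dual-antitone (B⊆ τ) (dual (opt τ))
          ; tight  = tight (opt τ) })

        ν-C : ∀ τ → ν (C τ) ≡ ν τ
        ν-C τ = sym (ν-optimal record
          { primal = Primal-mono (⊆C τ) (primal (opt τ))
          ; dual   = record { nonneg = nonneg (dual (opt τ)) ; cover = λ e → ∈-comprehension⁻ (covered? (w* τ)) }
          ; tight  = tight (opt τ) })

        -- The matching of σ is feasible on τ and the cover of τ is feasible on σ. With equal values
        -- the two form a pair optimal on both sets, and uniqueness identifies it with the chosen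
        -- pairs.
        fibre : ∀ {σ τ} → σ ⊆ τ → ν σ ≡ ν τ → B σ ≡ B τ × C σ ≡ C τ
        fibre {σ} {τ} σ⊆τ νσ≡ντ =
            tabulate-cong (λ e → cong (λ x → does (¬? (x ≟ 0#))) (f-unique onτ (opt τ) e))
          , tabulate-cong (λ e → cong (λ x → does (a e ≤? x))
              (sum-cong-≗ λ v → cong (Aᵀ e v *_) (w-unique (opt σ) onσ v)))
          where
          ft≡ : f* σ · a ≡ w* τ · b
          ft≡ = trans νσ≡ντ (tight (opt τ))
          onτ : Optimal τ (f* σ) (w* τ)
          onτ = record { primal = Primal-mono σ⊆τ (primal (opt σ)) ; dual = dual (opt τ) ; tight = ft≡ }
          onσ : Optimal σ (f* σ) (w* τ)
          onσ = record { primal = primal (opt σ) ; dual = Dual-antitone σ⊆τ (dual (opt τ)) ; tight = ft≡ }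

        -- A zero matching has value 0, which forces w = 0 since b is positive; a zero cover covers
        -- no edge of positive weight.
        B-⊥ : (∀ e → 0# < a e) → (∀ v → 0# < b v) → ∀ τ → B τ ≡ ⊥ → τ ≡ ⊥
        B-⊥ 0<a 0<b τ B≡⊥ = Subset.⊆-antisym τ⊆⊥ (Subset.⊆-min τ)
          where
          f≡0 : ∀ e → f* τ e ≡ 0#
          f≡0 e = ∉-supp (f* τ) (subst (e ∉_) (sym B≡⊥) Subset.∉⊥)

          0≡w·b : 0# ≡ w* τ · b
          0≡w·b = trans (sym (sum-zero λ e → trans (cong (_* a e) (f≡0 e)) (zeroˡ (a e)))) (tight (opt τ))

          w≡0 : ∀ v → w* τ v ≡ 0#
          w≡0 v = *-zero-product (<⇒≢ (0<b v)) (trans (*-comm (b v) _) (sym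
            (sum-mono-tight (λ v → *-nonneg (nonneg (dual (opt τ)) v) (0≤b v))
                            (trans (sum-replicate-zero p) 0≡w·b) v)))

          τ⊆⊥ : τ ⊆ ⊥
          τ⊆⊥ {e} e∈τ = contradiction (cover (dual (opt τ)) e e∈τ) (<⇒≱ (begin-strict
            Aᵀ e · w* τ   ≡⟨ sum-zero (λ v → trans (cong (Aᵀ e v *_) (w≡0 v)) (zeroʳ _)) ⟩
            0#            <⟨ 0<a e ⟩
            a e           ∎))

  -- Fractional matchings of uniform hypergraphs.

  module FractionalMatchings {nv m r : ℕ} (1≤r : 1 ≤ℕ r)
    (edge : Fin m → Subset nv) (uniform : ∀ e → ∣ edge e ∣ ≡ r) where
    open LinearAlgebra
    open Genericity

    indicator : ∀ {n} → Subset n → Fin n → Carrier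
    indicator S v = if lookup S v then 1# else 0#

    indicator-nonneg : ∀ {n} (S : Subset n) v → 0# ≤ indicator S v
    indicator-nonneg S v with lookup S v
    ... | true  = <⇒≤ 0<1
    ... | false = ≤-refl

    sum-indicator : ∀ {n} (S : Subset n) → sum (indicator S) ≡ fromℕ ∣ S ∣
    sum-indicator []            = refl
    sum-indicator (inside ∷ S)  = cong (1# +_) (sum-indicator S)
    sum-indicator (outside ∷ S) = trans (+-identityˡ _) (sum-indicator S)

    incidence : Fin nv → Fin m → Carrier
    incidence v e = indicator (edge e) v

    open LinearPrograms incidence

    0<fromℕr : 0# < fromℕ r
    0<fromℕr = <-≤-trans (fromℕ-suc-pos 0) (fromℕ-mono-≤ 1≤r)

    -- Uniformity enters here: every column of the incidence matrix sums to r.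
    incidence-constant : ∀ e x → transpose incidence e · (λ _ → x) ≡ fromℕ r * x
    incidence-constant e x = begin-equality
      transpose incidence e · (λ _ → x)  ≡⟨ *-distribʳ-sum x (indicator (edge e)) ⟨
      sum (indicator (edge e)) * x       ≡⟨ cong (_* x) (trans (sum-indicator (edge e)) (cong fromℕ (uniform e))) ⟩
      fromℕ r * x                        ∎

    module Weights (a : Fin m → Carrier) (0<a : ∀ e → 0# < a e)
                   (b : Fin nv → Carrier) (0<b : ∀ v → 0# < b v) where

      0≤sum-a : 0# ≤ sum a
      0≤sum-a = sum-nonneg (<⇒≤ ∘ 0<a)

      a≤r*sum-a : ∀ e → a e ≤ fromℕ r * sum a
      a≤r*sum-a e = begin
        a e               ≤⟨ term≤sum (<⇒≤ ∘ 0<a) e ⟩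
        sum a             ≡⟨ *-identityˡ (sum a) ⟨
        1# * sum a        ≤⟨ *-monoˡ-≤ 0≤sum-a (subst (_≤ fromℕ r) (+-identityʳ 1#) (fromℕ-mono-≤ 1≤r)) ⟩
        fromℕ r * sum a   ∎

      -- A crude cover of all of E, valid because r ≥ 1; strong duality only needs some cover to
      -- start from.
      cover : Fin nv → Carrier
      cover _ = sum a

      covers : ∀ e → a e ≤ transpose incidence e · cover
      covers e = subst (a e ≤_) (sym (incidence-constant e (sum a))) (a≤r*sum-a e)

      0≤b : ∀ v → 0# ≤ b v
      0≤b v = <⇒≤ (0<b v)

      0≤cover : ∀ v → 0# ≤ cover v
      0≤cover v = 0≤sum-a

      open Solved a b 0≤b cover 0≤cover covers public

      ν-⊥ : ν ⊥ ≡ 0#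
      ν-⊥ = sum-zero λ e → trans (cong (_* a e) (Primal.support (Optimal.primal (opt ⊥)) e Subset.∉⊥)) (zeroˡ (a e))

      -- `amin` and `bmin` are arbitrary lower bounds here, so the original minima can be used with
      -- the increased weights.
      ∣supp-w∣-bound : ∀ {amin bmin} → 0# ≤ amin → (∀ e → amin ≤ a e) → (∀ v → bmin ≤ b v) →
                       ∀ {τ f w} → Optimal τ f w → fromℕ ∣ supp w ∣ * (amin * bmin) ≤ fromℕ r * (f · a)
      ∣supp-w∣-bound {amin} {bmin} 0≤amin amin≤a bmin≤b {τ} {f} {w} O = begin
        fromℕ ∣ S ∣ * (amin * bmin)
          ≡⟨ solve 3 (λ s a b → s :* (a :* b) := a :* (s :* b)) refl (fromℕ ∣ S ∣) amin bmin ⟩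
        amin * (fromℕ ∣ S ∣ * bmin)
          ≡⟨ cong (λ s → amin * (s * bmin)) (sum-indicator S) ⟨
        amin * (sum (indicator S) * bmin)
          ≡⟨ cong (amin *_) (*-distribʳ-sum bmin (indicator S)) ⟩
        amin * sum (λ v → indicator S v * bmin)
          ≤⟨ *-monoʳ-≤ 0≤amin (sum-mono load-on-S) ⟩
        amin * sum (λ v → incidence v · f)
          ≡⟨ cong (amin *_) (sum-cong-≗ λ v → sym (*-identityˡ (incidence v · f))) ⟩
        -- Pairing with the all-ones vector makes the adjoint identity a double count of incidences.
        amin * ((λ _ → 1#) · (λ v → incidence v · f))
          ≡⟨ cong (amin *_) (·-adjoint incidence (λ _ → 1#) f) ⟩
        amin * (f · (λ e → transpose incidence e · (λ _ → 1#)))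
          ≡⟨ cong (amin *_) (sum-cong-≗ λ e → cong (f e *_) (trans (incidence-constant e 1#) (*-comm _ 1#))) ⟩
        amin * (f · (λ _ → 1# * fromℕ r))
          ≡⟨ cong (amin *_) (*-distribʳ-sum (1# * fromℕ r) f) ⟨
        amin * (sum f * (1# * fromℕ r))
          ≡⟨ solve 3 (λ a s r → a :* (s :* (:1 :* r)) := r :* (s :* a)) refl amin (sum f) (fromℕ r) ⟩
        fromℕ r * (sum f * amin)
          ≡⟨ cong (fromℕ r *_) (*-distribʳ-sum amin f) ⟩
        fromℕ r * (f · (λ _ → amin))
          ≤⟨ *-monoʳ-≤ (<⇒≤ 0<fromℕr) (·-monoʳ (Primal.nonneg P) amin≤a) ⟩
        fromℕ r * (f · a) ∎
        where
        S = supp w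
        P = Optimal.primal O
        load-on-S : ∀ v → indicator S v * bmin ≤ incidence v · f
        load-on-S v with lookup S v in v∈?S
        ... | false = subst (_≤ incidence v · f) (sym (zeroˡ bmin))
                            (·-nonneg (λ e → indicator-nonneg (edge e) v) (Primal.nonneg P))
        ... | true  = begin
          1# * bmin          ≡⟨ *-identityˡ bmin ⟩
          bmin               ≤⟨ bmin≤b v ⟩
          b v                ≡⟨ tight-vertex P (Optimal.dual O) (Optimal.tight O) v (∈-supp⁻ w (lookup⇒[]= v S v∈?S)) ⟨
          incidence v · f    ∎

      open Matching R edge a b

      -- Translates from `Feasible`, where values outside τ are arbitrary, to `Primal`, where they
      -- vanish.
      restrict : Subset m → (Fin m → Carrier) → Fin m → Carrier
      restrict τ f e = if lookup τ e then f e else 0#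

      value≡ : ∀ τ f → value τ f ≡ restrict τ f · a
      value≡ τ f = trans (sumFin≡sum m _) (sum-cong-≗ term)
        where
        term : ∀ e → (if lookup τ e then a e * f e else 0#) ≡ restrict τ f e * a e
        term e with lookup τ e
        ... | true  = *-comm (a e) (f e)
        ... | false = sym (zeroˡ (a e))

      load≡ : ∀ τ f v → Matching.load R edge a b τ f v ≡ incidence v · restrict τ f
      load≡ τ f v = trans (sumFin≡sum m _) (sum-cong-≗ term)
        where
        term : ∀ e → (if lookup τ e then (if lookup (edge e) v then f e else 0#) else 0#) ≡
                     incidence v e * restrict τ f e
        term e with lookup τ e | lookup (edge e) v
        ... | true  | true  = sym (*-identityˡ (f e))
        ... | true  | false = sym (zeroˡ (f e))
        ... | false | true  = sym (zeroʳ 1#)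
        ... | false | false = sym (zeroʳ 0#)

      feasible⇒primal : ∀ {τ f} → Feasible τ f → Primal τ (restrict τ f)
      feasible⇒primal {τ} {f} (0≤f , load≤b) = record
        { nonneg  = nonneg
        ; support = support
        ; load    = λ v → subst (_≤ b v) (load≡ τ f v) (load≤b v)
        }
        where
        nonneg : ∀ e → 0# ≤ restrict τ f e
        nonneg e with lookup τ e in e∈?τ
        ... | true  = 0≤f e e∈?τ
        ... | false = ≤-refl
        support : ∀ e → e ∉ τ → restrict τ f e ≡ 0#
        support e e∉τ with lookup τ e in e∈?τ
        ... | true  = contradiction (lookup⇒[]= e τ e∈?τ) e∉τ
        ... | false = refl

      restrict-primal : ∀ {τ f} → Primal τ f → ∀ e → restrict τ f e ≡ f e
      restrict-primal {τ} P e with lookup τ e in e∈?τ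
      ... | true  = refl
      ... | false = sym (Primal.support P e λ e∈τ → contradiction (trans (sym e∈?τ) ([]=⇒lookup e∈τ)) λ ())

      isNuStar-ν : ∀ τ → IsNuStar τ (ν τ)
      isNuStar-ν τ =
        (f* τ , ((λ e _ → Primal.nonneg P e) , λ v → begin
            Matching.load R edge a b τ (f* τ) v  ≡⟨ load≡ τ (f* τ) v ⟩
            incidence v · restrict τ (f* τ)      ≡⟨ sum-cong-≗ (λ e → cong (incidence v e *_) (restrict-primal P e)) ⟩
            incidence v · f* τ                   ≤⟨ Primal.load P v ⟩
            b v                                  ∎)
          , trans (value≡ τ (f* τ)) (·-congˡ a (restrict-primal P)))
        , λ f feasible → subst (_≤ ν τ) (sym (value≡ τ f)) (primal≤ν (feasible⇒primal feasible))
        where P = Optimal.primal (opt τ)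

      isNuStar-unique : ∀ {τ μ} → IsNuStar τ μ → μ ≡ ν τ
      isNuStar-unique {τ} {μ} ((f , feasible , refl) , ≤μ) = ≤-antisym
        (proj₂ (isNuStar-ν τ) f feasible)
        (subst (_≤ μ) (proj₂ (proj₂ (proj₁ (isNuStar-ν τ)))) (≤μ (f* τ) (proj₁ (proj₂ (proj₁ (isNuStar-ν τ))))))

    -- Perturbing the weights and collapsing the complex.

    module Collapse (a : Fin m → Carrier) (0<a : ∀ e → 0# < a e)
                    (b : Fin nv → Carrier) (0<b : ∀ v → 0# < b v)
                    (n : Carrier) (0<n : 0# < n) where

      module Original = Weights a 0<a b 0<b
      open Original using () renaming (ν to ν₀)

      -- An optimal cover has tight edges and would not survive an increase of a; strict
      -- inequalities do.
      StrictCover : Subset m → (Fin nv → Carrier) → Set c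
      StrictCover τ w = (∀ v → 0# ≤ w v) × (∀ e → e ∈ τ → a e < transpose incidence e · w) × w · b < n

      -- Adding ε to every vertex of the optimal cover gives each edge an extra r * ε > 0 and costs
      -- ε times the sum of b, less than the gap to n for small ε.
      strictCover : ∀ τ → ν₀ τ < n → ∃ (StrictCover τ)
      strictCover τ ντ<n =
        let ε , 0<ε , small = eventually-< ((λ _ → 1#) · b) (subst (_< n) (Original.Optimal.tight (Original.opt τ)) ντ<n)
        in raise ε 0<ε (small ε 0<ε ≤-refl)
        where
        D = Original.Optimal.dual (Original.opt τ)
        w = Original.w* τ

        raise : ∀ ε → 0# < ε → w · b + ε * ((λ _ → 1#) · b) < n → ∃ (StrictCover τ)
        raise ε 0<ε small = w⁺ , 0≤w⁺ , covers , subst (_< n) (sym w⁺·b) small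
          where
          w⁺ : Fin nv → Carrier
          w⁺ v = 1# * w v + ε * 1#

          0≤w⁺ : ∀ v → 0# ≤ w⁺ v
          0≤w⁺ v = +-nonneg (*-nonneg (<⇒≤ 0<1) (Original.Dual.nonneg D v)) (*-nonneg (<⇒≤ 0<ε) (<⇒≤ 0<1))

          w⁺·b : w⁺ · b ≡ w · b + ε * ((λ _ → 1#) · b)
          w⁺·b = trans (·-linearˡ 1# ε w (λ _ → 1#) b) (cong (_+ ε * ((λ _ → 1#) · b)) (*-identityˡ _))

          covers : ∀ e → e ∈ τ → a e < transpose incidence e · w⁺
          covers e e∈τ = begin-strict
            a e                                ≡⟨ +-identityˡ (a e) ⟨
            0# + a e                           <⟨ +-mono-< (a e) (*-pos 0<ε (*-pos 0<fromℕr 0<1)) ⟩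
            ε * (fromℕ r * 1#) + a e           ≤⟨ +-mono-≤ ≤-refl (Original.Dual.cover D e e∈τ) ⟩
            ε * (fromℕ r * 1#) + Ae · w        ≡⟨ cong (λ t → ε * t + Ae · w) (incidence-constant e 1#) ⟨
            ε * (Ae · (λ _ → 1#)) + Ae · w     ≡⟨ solve 2 (λ x y → x :+ y := :1 :* y :+ x) refl _ (Ae · w) ⟩
            1# * (Ae · w) + ε * (Ae · (λ _ → 1#))  ≡⟨ ·-linearʳ 1# ε Ae w (λ _ → 1#) ⟨
            Ae · w⁺                            ∎
            where Ae = transpose incidence e

      -- Made total with a dummy cover for non-faces, so that the cover depends on τ alone and not
      -- on a proof that τ is a face.
      strictCover? : ∀ τ → Dec (ν₀ τ < n) → ∃ λ w → ν₀ τ < n → StrictCover τ w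
      strictCover? τ (yes ντ<n) = proj₁ (strictCover τ ντ<n) , λ _ → proj₂ (strictCover τ ντ<n)
      strictCover? τ (no  ντ≮n) = (λ _ → 0#) , λ ντ<n → contradiction ντ<n ντ≮n

      abstract
        w⁺ : Subset m → Fin nv → Carrier
        w⁺ τ = proj₁ (strictCover? τ (ν₀ τ <? n))

        w⁺-strict : ∀ τ → ν₀ τ < n → StrictCover τ (w⁺ τ)
        w⁺-strict τ = proj₂ (strictCover? τ (ν₀ τ <? n))

      CoverBelow : Subset m × Fin m → (Fin m → Carrier) → Set c
      CoverBelow (τ , e) a′ = ν₀ τ < n × e ∈ τ → a′ e < transpose incidence e · w⁺ τ

      ValueBelow : Subset m → (Fin nv → Carrier) → Set c
      ValueBelow τ b′ = ν₀ τ < n → w⁺ τ · b′ < n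

      open-CoverBelow : ∀ τe → Open (CoverBelow τe)
      -- Bumping coordinate j by ε changes the weight of e by ε * δ j e.
      open-CoverBelow (τ , e) = open-when ((ν₀ τ <? n) ×-dec (e Subset.∈? τ)) λ x j → eventually-< (δ j e)

      open-ValueBelow : ∀ τ → Open (ValueBelow τ)
      open-ValueBelow τ = open-when (ν₀ τ <? n) (open-·< (w⁺ τ) n)

      perturbed-a : ∃ λ a′ → (∀ e → a e ≤ a′ e) ×
                    (∀ {τe} → τe ∈ᴸ cartesianProduct (allSubsets m) (allFin m) → CoverBelow τe a′) ×
                    Generic incidence a′
      perturbed-a = perturb incidence (open-All (cartesianProduct (allSubsets m) (allFin m)) open-CoverBelow) a
        λ {(τ , e)} _ (ντ<n , e∈τ) → proj₁ (proj₂ (w⁺-strict τ ντ<n)) e e∈τ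

      perturbed-b : ∃ λ b′ → (∀ v → b v ≤ b′ v) × (∀ {τ} → τ ∈ᴸ allSubsets m → ValueBelow τ b′) ×
                    Generic (transpose incidence) b′
      perturbed-b = perturb (transpose incidence) (open-All (allSubsets m) open-ValueBelow) b
        λ {τ} _ ντ<n → proj₂ (proj₂ (w⁺-strict τ ντ<n))

      a′ = proj₁ perturbed-a
      b′ = proj₁ perturbed-b
      a≤a′ = proj₁ (proj₂ perturbed-a)
      b≤b′ = proj₁ (proj₂ perturbed-b)

      module Perturbed = Weights a′ (λ e → <-≤-trans (0<a e) (a≤a′ e)) b′ (λ v → <-≤-trans (0<b v) (b≤b′ v))
      open Perturbed using () renaming (ν to ν₁)
      open Perturbed.Unique (proj₂ (proj₂ (proj₂ perturbed-a))) (proj₂ (proj₂ (proj₂ perturbed-b)))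

      -- The strict cover fixed for τ still covers it under the new a and still has total weight
      -- below n under the new b.
      ν₀<n⇒ν₁<n : ∀ τ → ν₀ τ < n → ν₁ τ < n
      ν₀<n⇒ν₁<n τ ντ<n = begin-strict
        ν₁ τ        ≤⟨ Perturbed.weak-duality (Perturbed.Optimal.primal (Perturbed.opt τ)) D ⟩
        w⁺ τ · b′   <⟨ proj₁ (proj₂ (proj₂ perturbed-b)) (∈-allSubsets τ) ντ<n ⟩
        n           ∎
        where
        D : Perturbed.Dual τ (w⁺ τ)
        D = record
          { nonneg = proj₁ (w⁺-strict τ ντ<n)
          ; cover  = λ e e∈τ → <⇒≤ (proj₁ (proj₂ (proj₂ perturbed-a))
              (∈-cartesianProduct⁺ (∈-allSubsets τ) (∈-allFin e)) (ντ<n , e∈τ)) }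

      -- Larger capacities keep the old optimal matching feasible, and larger edge weights do not
      -- lower its value.
      ν₁<n⇒ν₀<n : ∀ τ → ν₁ τ < n → ν₀ τ < n
      ν₁<n⇒ν₀<n τ = ≤-<-trans (begin
        Original.f* τ · a    ≤⟨ ·-monoʳ (Original.Primal.nonneg P) a≤a′ ⟩
        Original.f* τ · a′   ≤⟨ Perturbed.primal≤ν P′ ⟩
        ν₁ τ                 ∎)
        where
        P = Original.Optimal.primal (Original.opt τ)
        P′ : Perturbed.Primal τ (Original.f* τ)
        P′ = record { nonneg = Original.Primal.nonneg P ; support = Original.Primal.support P
                    ; load = λ v → ≤-trans (Original.Primal.load P v) (b≤b′ v) }

      totalOrder : TotalOrder c c c
      totalOrder = record { isTotalOrder = isTotalOrder }

      open IntervalCollapse totalOrder ν₁ B C Perturbed.ν-mono B⊆ ⊆C ν-B ν-C fibre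
        (B-⊥ (λ e → <-≤-trans (0<a e) (a≤a′ e)) (λ v → <-≤-trans (0<b v) (b≤b′ v)))

      X : Subset m → Set c
      X τ = ∃ λ μ → Matching.IsNuStar R edge a b τ μ × μ < n

      X⇒ν₀<n : ∀ {τ} → X τ → ν₀ τ < n
      X⇒ν₀<n (μ , isNuStar , μ<n) = subst (_< n) (Original.isNuStar-unique isNuStar) μ<n

      ν₀<n⇒X : ∀ {τ} → ν₀ τ < n → X τ
      ν₀<n⇒X {τ} ντ<n = ν₀ τ , Original.isNuStar-ν τ , ντ<n

      collapsible-X : ∀ {amin bmin k} → 0# ≤ amin → (∀ e → amin ≤ a e) → (∀ v → bmin ≤ b v) →
                      fromℕ r * n ≤ fromℕ (suc k) * (amin * bmin) → 0# ≤ bmin → Collapsible k X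
      collapsible-X {amin} {bmin} {k} 0≤amin amin≤a bmin≤b rn≤ 0≤bmin = collapsible record
        { dec    = λ τ → map′ ν₀<n⇒X X⇒ν₀<n (ν₀ τ <? n)
        ; empty  = ν₀<n⇒X (subst (_< n) (sym Original.ν-⊥) 0<n)
        ; down   = λ σ⊆τ Xτ → ν₀<n⇒X (≤-<-trans (Original.ν-mono σ⊆τ) (X⇒ν₀<n Xτ))
        -- `C` preserves only the perturbed value, so membership passes to the perturbed complex and
        -- back.
        ; closed = λ {τ} Xτ → ν₀<n⇒X (ν₁<n⇒ν₀<n (C τ) (subst (_< n) (sym (ν-C τ)) (ν₀<n⇒ν₁<n τ (X⇒ν₀<n Xτ))))
        ; small  = λ {τ} Xτ → ℕ.≤-trans (∣supp-f∣≤∣supp-w∣ (Perturbed.opt τ)) (∣supp-w∣≤k τ (ν₀<n⇒ν₁<n τ (X⇒ν₀<n Xτ)))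
        }
        where
        ∣supp-w∣≤k : ∀ τ → ν₁ τ < n → ∣ supp (Perturbed.w* τ) ∣ ≤ℕ k
        -- Support size at least k + 1 would give (k + 1) * amin * bmin ≤ r * ν₁ < r * n, against
        -- the choice of k. The strict bound on ν₁ is what saves the 1 after the ceiling.
        ∣supp-w∣≤k τ ντ<n = ℕ.≮⇒≥ λ k<s → <-irrefl refl (begin-strict
          fromℕ (suc k) * (amin * bmin)   ≤⟨ *-monoˡ-≤ (*-nonneg 0≤amin 0≤bmin) (fromℕ-mono-≤ k<s) ⟩
          fromℕ ∣ supp (Perturbed.w* τ) ∣ * (amin * bmin)
            ≤⟨ Perturbed.∣supp-w∣-bound 0≤amin (λ e → ≤-trans (amin≤a e) (a≤a′ e)) (λ v → ≤-trans (bmin≤b v) (b≤b′ v)) (Perturbed.opt τ) ⟩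
          fromℕ r * ν₁ τ                  <⟨ *-monoʳ-< 0<fromℕr ντ<n ⟩
          fromℕ r * n                     ≤⟨ rn≤ ⟩
          fromℕ (suc k) * (amin * bmin)   ∎)

-- The dimension is written without division: k is the largest natural number with k * amin * bmin <
-- r * n, that is, the ceiling of r * n / (amin * bmin) minus 1.
theorem12 : ∀ {c} (R : RealField c) → let open RealField R in
    (r : ℕ) → 2 ≤ℕ r →
    (nv m : ℕ) (edge : Fin m → Subset nv) →
    Injective _≡_ _≡_ edge →
    (∀ e → ∣ edge e ∣ ≡ r) →
    (a : Fin m → Carrier) → (∀ e → 0# < a e) →
    (b : Fin nv → Carrier) → (∀ v → 0# < b v) →
    (amin : Carrier) → (∃ λ e → a e ≡ amin) → (∀ e → amin ≤ a e) →
    (bmin : Carrier) → (∃ λ v → b v ≡ bmin) → (∀ v → bmin ≤ b v) →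
    (n : Carrier) → amin * bmin < n →
    (k : ℕ) → fromℕ k * (amin * bmin) < fromℕ r * n →
    fromℕ r * n ≤ fromℕ (suc k) * (amin * bmin) →
    Collapsible k (λ E' → ∃ λ μ → Matching.IsNuStar R edge a b E' μ × μ < n)
theorem12 R r 2≤r nv m edge _ uniform a 0<a b 0<b
  amin (e , ae≡amin) amin≤a bmin (v , bv≡bmin) bmin≤b n amin*bmin<n k _ rn≤ =
  OverRealField.FractionalMatchings.Collapse.collapsible-X R
    -- Both minima are attained, hence positive, so n > amin * bmin > 0 and the empty set is a face.
    (ℕ.≤-trans (ℕ.n≤1+n 1) 2≤r) edge uniform a 0<a b 0<b n (<-trans (*-pos 0<amin 0<bmin) amin*bmin<n)
    (inj₁ 0<amin) amin≤a bmin≤b rn≤ (inj₁ 0<bmin)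
  where
  open RealField R
  open IsStrictTotalOrder isStrictTotalOrder using () renaming (trans to <-trans)
  0<amin : 0# < amin
  0<amin = subst (0# <_) ae≡amin (0<a e)
  0<bmin : 0# < bmin
  0<bmin = subst (0# <_) bv≡bmin (0<b v)
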